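{- Let $s\ge1$. There exists a bijection $\Psi\colon\mathrm{RC}^{HW}(B^{2,s})\to\mathcal A$ such that, for all $(\nu,J)\in\mathrm{RC}^{HW}(B^{2,s})$, $$\mathrm{cc}(\nu,J)=\mathrm{gr}\bigl(\Psi(\nu,J)\bigr),\qquad\overline{\mathrm{wt}}(\nu,J)=\overline{\mathrm{wt}}\bigl(\Psi(\nu,J)\bigr).$$
   Context: **Setting.** Type $D_4^{(3)}$, classical subalgebra of type $G_2$ with $I_0=\{1,2\}$, $A_{11}=A_{22}=2$, $A_{12}=\langle h_1,\alpha_2\rangle=-3$, $A_{21}=-1$, $\overline\alpha_1=2\overline\Lambda_1-\overline\Lambda_2$, $\overline\alpha_2=-3\overline\Lambda_1+2\overline\Lambda_2$. **The index set.** $\mathcal A=\{r=(r_1,r_2,r_3,r_4)\in\mathbb Z_{\ge0}^4\mid r_3\le r_1,\ r_1+r_2+r_3+r_4\le s\}$, $\overline{\mathrm{wt}}(r)=(r_1+r_2-r_3)\overline\Lambda_1+(s-r_1-r_2-r_4)\overline\Lambda_2$, $\mathrm{gr}(r)=r_1+2r_2+2r_3+3r_4$. **Highest weight rigged configurations for $B^{2,s}$.** A configuration is a pair of partitions $\nu=(\nu^{(1)},\nu^{(2)})$; $m_i^{(a)}$ is the number of parts $i$ in $\nu^{(a)}$; vacancy numbers $p_i^{(a)}=\delta_{a,2}\min(i,s)-\sum_{b\in I_0,\,j\ge1}A_{ab}\min(i,j)m_j^{(b)}$. $\mathrm{RC}^{HW}(B^{2,s})$ is the set of pairs $(\nu,J)$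 with $J_i^{(a)}$ a multiset of $m_i^{(a)}$ integers $x$ with $0\le x\le p_i^{(a)}$, and with dominant weight $\overline{\mathrm{wt}}(\nu,J)=s\overline\Lambda_2-|\nu^{(1)}|\overline\alpha_1-|\nu^{(2)}|\overline\alpha_2$. **Cocharge.** $\mathrm{cc}(\nu,J)=\frac12\sum_{a,b\in I_0}\sum_{i,j\ge1}(\alpha_a|\alpha_b)\min(i,j)m_i^{(a)}m_j^{(b)}+\sum_{a\in I_0}t_a^\vee\sum_{i\ge1}\sum_{x\in J_i^{(a)}}x$, where $t_1^\vee=1$, $t_2^\vee=3$, $(\alpha_1|\alpha_1)=2$, $(\alpha_1|\alpha_2)=-3$, $(\alpha_2|\alpha_2)=6$. -}

module Defs where

open import Data.Fin.Base using (Fin; zero; suc; toℕ)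
open import Data.Fin.Properties as Fin using ()
open import Data.Integer.Base as ℤ using (ℤ; +_; -[1+_]; _+_; _-_; _*_)
open import Data.Integer.Properties using (+-*-semiring)
open import Data.List.Base using (List; []; _∷_; foldr; length; filter)
open import Data.List.Properties using (filter-reject)
open import Data.List.Relation.Binary.Permutation.Propositional
  using (_↭_; ↭-refl; ↭-sym; ↭-trans)
open import Data.List.Relation.Unary.All using (All)
open import Data.List.Relation.Unary.Linked using (Linked)
open import Data.Nat.Base as ℕ using (ℕ; suc; _⊓_)
open import Data.Nat.ListAction using () renaming (sum to sumℕ)
open import Data.Nat.Properties as ℕ using (m≤m+n; m≤n+m; ≤-<-trans; <⇒≢)
open import Data.Product.Base using (_×_; _,_; proj₁; proj₂; zip; map)
open import Data.Rational.Base as ℚ using (ℚ)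
open import Level using (0ℓ)
open import Relation.Binary.Bundles using (Setoid)
open import Relation.Binary.PropositionalEquality
  using (_≡_; refl; sym; trans; cong; setoid)
open import Relation.Nullary.Decidable using (does)
open import Data.Bool.Base using (if_then_else_)
open import Algebra.Properties.Semiring.Sum +-*-semiring public
  using (sum; sum-syntax)

------------------------------------------------------------------------
-- Cartan data

I₀ : Set
I₀ = Fin 2

pattern 𝟏 = zero
pattern 𝟐 = suc zero

∑I₀ : (I₀ → ℤ) → ℤ
∑I₀ f = ∑[ a < 2 ] f a

A : I₀ → I₀ → ℤ
A 𝟏 𝟏 = + 2
A 𝟏 𝟐 = -[1+ 2 ]
A 𝟐 𝟏 = -[1+ 0 ]
A 𝟐 𝟐 = + 2

⟨α_∣α_⟩ : I₀ → I₀ → ℤ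
⟨α 𝟏 ∣α 𝟏 ⟩ = + 2
⟨α 𝟏 ∣α 𝟐 ⟩ = -[1+ 2 ]
⟨α 𝟐 ∣α 𝟏 ⟩ = -[1+ 2 ]
⟨α 𝟐 ∣α 𝟐 ⟩ = + 6

t^∨ : I₀ → ℤ
t^∨ 𝟏 = + 1
t^∨ 𝟐 = + 3

δ : I₀ → I₀ → ℤ
δ a b = if does (a Fin.≟ b) then + 1 else + 0

-- The classical weight lattice, in coordinates with respect to Λ̄₁ and Λ̄₂.
Weight : Set
Weight = ℤ × ℤ

infixl 6 _⊕_ _⊖_
infixr 7 _·_

_⊕_ _⊖_ : Weight → Weight → Weight
_⊕_ = zip _+_ _+_
_⊖_ = zip _-_ _-_

_·_ : ℤ → Weight → Weight
c · μ = map (c *_) (c *_) μ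

Λ̄₁ Λ̄₂ ᾱ₁ ᾱ₂ : Weight
Λ̄₁ = + 1 , + 0
Λ̄₂ = + 0 , + 1
ᾱ₁ = (+ 2) · Λ̄₁ ⊖ Λ̄₂
ᾱ₂ = -[1+ 2 ] · Λ̄₁ ⊕ (+ 2) · Λ̄₂

Dominant : Weight → Set
Dominant μ = (+ 0 ℤ.≤ proj₁ μ) × (+ 0 ℤ.≤ proj₂ μ)

------------------------------------------------------------------------
-- Partitions and configurations

record Partition : Set where
  field
    parts      : List ℕ
    positive   : All (0 ℕ.<_) parts
    decreasing : Linked ℕ._≥_ parts

open Partition public

∣_∣ₚ : Partition → ℕ
∣ λ′ ∣ₚ = sumℕ (parts λ′)

mult : ℕ → Partition → ℕ
mult i λ′ = length (filter (ℕ._≟ i) (parts λ′))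

-- The sum of f 1 , … , f n.
∑[1⋯_] : ℕ → (ℕ → ℤ) → ℤ
∑[1⋯ n ] f = ∑[ k < n ] f (suc (toℕ k))

-- No part exceeds the size, so sums over i ≥ 1 of terms that vanish when
-- mult i λ′ ≡ 0 may be cut off at ∣ λ′ ∣ₚ, as is done below.
mult-vanishes : ∀ λ′ {i} → ∣ λ′ ∣ₚ ℕ.< i → mult i λ′ ≡ 0
mult-vanishes λ′ = go (parts λ′)
  where
  go : ∀ xs {i} → sumℕ xs ℕ.< i → length (filter (ℕ._≟ i) xs) ≡ 0
  go []       _ = refl
  go (x ∷ xs) {i} lt = trans
    (cong length (filter-reject (ℕ._≟ i) (<⇒≢ (≤-<-trans (m≤m+n x (sumℕ xs)) lt))))
    (go xs (≤-<-trans (m≤n+m (sumℕ xs) x) lt))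

Configuration : Set
Configuration = I₀ → Partition

m : Configuration → I₀ → ℕ → ℕ
m ν a i = mult i (ν a)

vacancy : ℕ → Configuration → I₀ → ℕ → ℤ
vacancy s ν a i =
  δ a 𝟐 * (+ (i ⊓ s))
  - ∑I₀ λ b → ∑[1⋯ ∣ ν b ∣ₚ ] λ j → A a b * (+ (i ⊓ j)) * (+ m ν b j)

wtConf : ℕ → Configuration → Weight
wtConf s ν = (+ s) · Λ̄₂ ⊖ (+ ∣ ν 𝟏 ∣ₚ) · ᾱ₁ ⊖ (+ ∣ ν 𝟐 ∣ₚ) · ᾱ₂

------------------------------------------------------------------------
-- Highest weight rigged configurations

-- The multiset J a i is represented by a list, taken up to permutation in
-- RCᴴᵂ-setoid.  At i = 0 the list is forced to be empty, because all parts
-- are positive.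
record RCᴴᵂ (s : ℕ) : Set where
  field
    ν        : Configuration
    J        : I₀ → ℕ → List ℤ
    J-length : ∀ a i → length (J a i) ≡ m ν a i
    J-bounds : ∀ a i → All (λ x → (+ 0 ℤ.≤ x) × (x ℤ.≤ vacancy s ν a i)) (J a i)
    dominant : Dominant (wtConf s ν)

open RCᴴᵂ public

infix 4 _≈ᴿᶜ_

_≈ᴿᶜ_ : ∀ {s} → RCᴴᵂ s → RCᴴᵂ s → Set
R ≈ᴿᶜ R′ = (∀ a → parts (ν R a) ≡ parts (ν R′ a))
         × (∀ a i → J R a i ↭ J R′ a i)

RCᴴᵂ-setoid : ℕ → Setoid 0ℓ 0ℓ
RCᴴᵂ-setoid s = record
  { Carrier       = RCᴴᵂ s
  ; _≈_           = _≈ᴿᶜ_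
  ; isEquivalence = record
    { refl  = (λ _ → refl) , (λ _ _ → ↭-refl)
    ; sym   = λ (p , q) → (λ a → sym (p a)) , (λ a i → ↭-sym (q a i))
    ; trans = λ (p , q) (p′ , q′) →
        (λ a → trans (p a) (p′ a)) , (λ a i → ↭-trans (q a i) (q′ a i))
    }
  }

wtRC : ∀ {s} → RCᴴᵂ s → Weight
wtRC {s} R = wtConf s (ν R)

infix 8 _/1

_/1 : ℤ → ℚ
z /1 = z ℚ./ 1

sumℤ : List ℤ → ℤ
sumℤ = foldr _+_ (+ 0)

cc : ∀ {s} → RCᴴᵂ s → ℚ
cc R = ℚ.½ ℚ.* quadratic /1 ℚ.+ riggings /1
  where
  μ = ν R

  quadratic : ℤ
  quadratic =
    ∑I₀ λ a → ∑I₀ λ b →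
      ∑[1⋯ ∣ μ a ∣ₚ ] λ i → ∑[1⋯ ∣ μ b ∣ₚ ] λ j →
        ⟨α a ∣α b ⟩ * (+ (i ⊓ j)) * (+ m μ a i) * (+ m μ b j)

  riggings : ℤ
  riggings = ∑I₀ λ a → t^∨ a * ∑[1⋯ ∣ μ a ∣ₚ ] λ i → sumℤ (J R a i)

------------------------------------------------------------------------
-- The index set

-- Propositional equality on 𝒜 s is equality of the four entries, since
-- proofs of ℕ._≤_ are unique.
record 𝒜 (s : ℕ) : Set where
  field
    r₁ r₂ r₃ r₄ : ℕ
    r₃≤r₁       : r₃ ℕ.≤ r₁
    total≤s     : r₁ ℕ.+ r₂ ℕ.+ r₃ ℕ.+ r₄ ℕ.≤ s

𝒜-setoid : ℕ → Setoid 0ℓ 0ℓ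
𝒜-setoid s = setoid (𝒜 s)

module _ {s : ℕ} (r : 𝒜 s) where
  open 𝒜 r

  wt𝒜 : Weight
  wt𝒜 = (+ r₁ + + r₂ - + r₃) · Λ̄₁ ⊕ (+ s - + r₁ - + r₂ - + r₄) · Λ̄₂

  gr : ℕ
  gr = r₁ ℕ.+ 2 ℕ.* r₂ ℕ.+ 2 ℕ.* r₃ ℕ.+ 3 ℕ.* r₄

{-# OPTIONS --safe #-}
-- Nonnegativity of the vacancy numbers at the smallest parts bounds the
-- numbers of rows of (ν⁽¹⁾ , ν⁽²⁾), leaving only (0 , 0), (1 , 1) and (3 , 2).
-- Evaluating it at the remaining parts shows that, up to empty rows,
-- ν⁽¹⁾ = (a , c , c) and ν⁽²⁾ = (b , c), where c ≤ b ≤ a, b ≤ s and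
-- 2a + c ≤ 3b.  Every vacancy number at a part is then zero, except possibly
-- 3b − 2a − c at the row a of ν⁽¹⁾, so the riggings reduce to one number x
-- with 0 ≤ x ≤ 3b − 2a − c, and cc = a + 2c + x.  The bijection is
-- r₄ = c, r₃ = a − b, r₂ = x, r₁ = 2b − a − c − x.
module Submission where

open import Defs
open import Data.Integer.Properties as ℤ using ()
open import Algebra.Properties.Semiring.Sum ℤ.+-*-semiring
  using (sum-cong-≗; sum-replicate-zero; ∑-distrib-+)
open import Data.Bool.Base using (true; false; if_then_else_)
open import Data.Fin.Base using (toℕ)
open import Data.Integer.Base as ℤ using (ℤ; +_; -[1+_])
open import Data.Integer.Base using () renaming (_+_ to _⊞_; _*_ to _⊠_; _-_ to _⊟_)
open import Data.Integer.Tactic.RingSolver using () renaming (solve-∀ to ℤ-ring)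
open import Data.List.Base using (List; []; _∷_; map; filter; length)
open import Data.List.Membership.Propositional using (_∈_)
open import Data.List.Membership.Propositional.Properties using (∈-filter⁺; ∈-filter⁻)
open import Data.List.Properties using (length-map; map-id; filter-accept; filter-all; filter-none)
open import Data.List.Relation.Binary.Permutation.Propositional using (↭-reflexive; ↭⇒↭ₛ)
open import Data.List.Relation.Binary.Permutation.Setoid.Properties using (foldr-commMonoid)
open import Data.List.Relation.Unary.All as All using (All; []; _∷_)
open import Data.List.Relation.Unary.All.Properties as All using (all-filter)
open import Data.List.Relation.Unary.Any using (here; there)
open import Data.List.Relation.Unary.Linked using (Linked; [-]; _∷_)
open import Data.List.Relation.Unary.Linked.Properties as Linked using ()
open import Data.Nat.Base using (ℕ; zero; suc; _+_; _*_; _≤_; _<_; _≥_; z≤n; s≤s; z<s; _⊓_; _≡ᵇ_;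
  >-nonZero)
open import Data.Nat.ListAction using () renaming (sum to sumℕ)
open import Data.Nat.Properties
open import Data.Nat.Tactic.RingSolver using () renaming (solve-∀ to ℕ-ring)
open import Data.Product.Base using (Σ-syntax; ∃-syntax; _×_; _,_; proj₁; proj₂)
open import Data.Rational.Base as ℚ using (ℚ)
open import Data.Rational.Properties
  using (toℚᵘ-injective; toℚᵘ-fromℚᵘ; toℚᵘ-homo-+; toℚᵘ-homo-*)
open import Data.Rational.Unnormalised.Base as ℚᵘ using (mkℚᵘ; *≡*)
open import Data.Rational.Unnormalised.Properties as ℚᵘ using (≃-trans; ≃-sym; +-cong; *-cong)
open import Data.Sum.Base using (_⊎_; inj₁; inj₂)
open import Data.Unit.Base using (tt)
open import Function.Base using (_∘_; _on_)
open import Function.Bundles using (Bijection)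
open import Level using (0ℓ)
open import Relation.Binary.Bundles using (Setoid)
open import Relation.Binary.PropositionalEquality hiding (J)
open import Relation.Nullary.Decidable using (does; yes; no)
open import Relation.Nullary.Negation using (contradiction)
open import Relation.Unary using (Pred; Decidable)

-- Each minimum `i ⊓ x` counted by `Q i` is at most `i`. At the parts, taken in a suitable order,
-- the inequalities leave almost no room, so the minima must attain their bounds; this rigidity pins
-- down the shapes. The formulas for the index turn the remaining inequalities into those of `𝒜`.
-- Indeed r₁ + r₂ + r₃ + r₄ = b and r₁ - r₃ = 3b - 2a - c - x, so b ≤ s is `total≤s` and x ≤ 3b - 2a
-- - c is `r₃≤r₁`, while c ≥ 0, b ≤ a and x ≥ 0 say that r₄, r₃ and r₂ are nonnegative. Riggings are
-- known only up to permutation, so a rigged configuration is not a convenient object to compute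
-- with. The explicit map is therefore the inverse one, `fromIndex`: every rigged configuration is
-- equivalent to `fromIndex r` for exactly one `r`, and cocharge and weight, being invariant, need
-- evaluation only there.

private variable
  X Y : Set

-- Sums over configurations

∑-cong : ∀ n {f g : ℕ → ℤ} → (∀ i → f i ≡ g i) → ∑[1⋯ n ] f ≡ ∑[1⋯ n ] g
∑-cong n eq = sum-cong-≗ {n} (eq ∘ suc ∘ toℕ)

∑-indicator : ∀ n {k} c → 0 < k → k ≤ n →
              ∑[1⋯ n ] (λ i → if does (k ≟ i) then c else + 0) ≡ c
∑-indicator (suc n) {suc zero} c _ _ =
  trans (cong (ℤ._+_ c) (sum-replicate-zero n)) (ℤ.+-identityʳ c)
∑-indicator (suc n) {suc (suc k)} c _ (s≤s k<n) =
  trans (ℤ.+-identityˡ _) (∑-indicator n c (s≤s z≤n) k<n)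

-- Every entry lies over exactly one index, its key, and the bounds place that index within the
-- range of summation. With the identity as key this removes multiplicities; with the row length as
-- key it adds up riggings.
∑-fibres : ∀ n (key : X → ℕ) (g : X → ℤ) {xs} →
           All (λ b → 0 < key b × key b ≤ n) xs →
           ∑[1⋯ n ] (λ i → sumℤ (map g (filter (λ b → key b ≟ i) xs)))
             ≡ sumℤ (map g xs)
∑-fibres n key g [] = sum-replicate-zero n
∑-fibres n key g {b ∷ xs} ((0<k , k≤n) ∷ bounds) = begin
  ∑[1⋯ n ] (λ i → sumℤ (map g (filter (λ b → key b ≟ i) (b ∷ xs))))
    ≡⟨ ∑-cong n split ⟩
  ∑[1⋯ n ] (λ i → (if does (key b ≟ i) then g b else + 0) ℤ.+ fibre i)
    ≡⟨ ∑-distrib-+ {n} _ _ ⟩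
  ∑[1⋯ n ] (λ i → if does (key b ≟ i) then g b else + 0) ℤ.+ ∑[1⋯ n ] fibre
    ≡⟨ cong₂ ℤ._+_ (∑-indicator n (g b) 0<k k≤n) (∑-fibres n key g bounds) ⟩
  sumℤ (map g (b ∷ xs)) ∎
  where
  open ≡-Reasoning
  fibre : ℕ → ℤ
  fibre i = sumℤ (map g (filter (λ b → key b ≟ i) xs))
  split : ∀ i → sumℤ (map g (filter (λ b → key b ≟ i) (b ∷ xs)))
              ≡ (if does (key b ≟ i) then g b else + 0) ℤ.+ fibre i
  split i with does (key b ≟ i)
  ... | true  = refl
  ... | false = sym (ℤ.+-identityˡ _)

parts-bounded : ∀ λ′ → All (λ i → 0 < i × i ≤ ∣ λ′ ∣ₚ) (parts λ′)
parts-bounded λ′ = All.zip (positive λ′ , go (parts λ′))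
  where
  go : ∀ xs → All (_≤ sumℕ xs) xs
  go []       = []
  go (x ∷ xs) = m≤m+n x _ ∷ All.map (λ p → ≤-trans p (m≤n+m _ x)) (go xs)

∑-mult : ∀ λ′ (f : ℕ → ℤ) →
         ∑[1⋯ ∣ λ′ ∣ₚ ] (λ j → f j ℤ.* + mult j λ′) ≡ sumℤ (map f (parts λ′))
∑-mult λ′ f = trans (∑-cong ∣ λ′ ∣ₚ (λ j → constant j (parts λ′)))
                    (∑-fibres ∣ λ′ ∣ₚ (λ i → i) f (parts-bounded λ′))
  where
  constant : ∀ j xs → f j ℤ.* + length (filter (_≟ j) xs)
                    ≡ sumℤ (map f (filter (_≟ j) xs))
  constant j []       = ℤ.*-zeroʳ (f j)
  constant j (x ∷ xs) with x ≡ᵇ j | ≡ᵇ⇒≡ x j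
  ... | false | _   = constant j xs
  ... | true  | x≡j with refl ← x≡j tt =
    trans (ℤ.*-suc (f j) _) (cong (ℤ._+_ (f j)) (constant j xs))

-- Q i counts the cells in the first i columns.
Q : ℕ → List ℕ → ℕ
Q i xs = sumℕ (map (i ⊓_) xs)

QQ : List ℕ → List ℕ → ℕ
QQ xs ys = sumℕ (map (λ i → Q i ys) xs)

sumℤ-scale : ∀ c (f : ℕ → ℕ) xs →
             sumℤ (map (λ i → c ℤ.* + f i) xs) ≡ c ℤ.* + sumℕ (map f xs)
sumℤ-scale c f []       = sym (ℤ.*-zeroʳ c)
sumℤ-scale c f (x ∷ xs) = trans (cong (ℤ._+_ (c ℤ.* + f x)) (sumℤ-scale c f xs))
                                (sym (ℤ.*-distribˡ-+ c (+ f x) (+ sumℕ (map f xs))))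

∑-min : ∀ c i λ′ → ∑[1⋯ ∣ λ′ ∣ₚ ] (λ j → c ℤ.* + (i ⊓ j) ℤ.* + mult j λ′)
                   ≡ c ℤ.* + Q i (parts λ′)
∑-min c i λ′ = trans (∑-mult λ′ (λ j → c ℤ.* + (i ⊓ j)))
                     (sumℤ-scale c (i ⊓_) (parts λ′))

∑∑-min : ∀ c λ′ μ →
  ∑[1⋯ ∣ λ′ ∣ₚ ] (λ i → ∑[1⋯ ∣ μ ∣ₚ ] (λ j →
    c ℤ.* + (i ⊓ j) ℤ.* + mult i λ′ ℤ.* + mult j μ))
  ≡ c ℤ.* + QQ (parts λ′) (parts μ)
∑∑-min c λ′ μ = begin
  ∑[1⋯ ∣ λ′ ∣ₚ ] (λ i → ∑[1⋯ ∣ μ ∣ₚ ] (λ j →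
    c ℤ.* + (i ⊓ j) ℤ.* + mult i λ′ ℤ.* + mult j μ))
    ≡⟨ ∑-cong ∣ λ′ ∣ₚ inner ⟩
  ∑[1⋯ ∣ λ′ ∣ₚ ] (λ i → c ℤ.* + Q i (parts μ) ℤ.* + mult i λ′)
    ≡⟨ ∑-mult λ′ _ ⟩
  sumℤ (map (λ i → c ℤ.* + Q i (parts μ)) (parts λ′))
    ≡⟨ sumℤ-scale c (λ i → Q i (parts μ)) (parts λ′) ⟩
  c ℤ.* + QQ (parts λ′) (parts μ) ∎
  where
  open ≡-Reasoning
  exchange : ∀ x y z → x ℤ.* y ℤ.* z ≡ x ℤ.* z ℤ.* y
  exchange = ℤ-ring
  inner : ∀ i → ∑[1⋯ ∣ μ ∣ₚ ] (λ j → c ℤ.* + (i ⊓ j) ℤ.* + mult i λ′ ℤ.* + mult j μ)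
              ≡ c ℤ.* + Q i (parts μ) ℤ.* + mult i λ′
  -- The factor `mult i λ′` joins the constant `c`, so that `∑-min` evaluates the inner sum, and
  -- then moves last again, where `∑-mult` expects it.
  inner i = begin
    ∑[1⋯ ∣ μ ∣ₚ ] (λ j → c ℤ.* + (i ⊓ j) ℤ.* + mult i λ′ ℤ.* + mult j μ)
      ≡⟨ ∑-cong ∣ μ ∣ₚ (λ j →
           cong (λ z → z ℤ.* + mult j μ) (exchange c (+ (i ⊓ j)) (+ mult i λ′))) ⟩
    ∑[1⋯ ∣ μ ∣ₚ ] (λ j → c ℤ.* + mult i λ′ ℤ.* + (i ⊓ j) ℤ.* + mult j μ)
      ≡⟨ ∑-min (c ℤ.* + mult i λ′) i μ ⟩
    c ℤ.* + mult i λ′ ℤ.* + Q i (parts μ)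
      ≡⟨ exchange c (+ mult i λ′) (+ Q i (parts μ)) ⟩
    c ℤ.* + Q i (parts μ) ℤ.* + mult i λ′ ∎

-- Both vacancy numbers are put as differences of natural numbers, so that bounds on them become
-- inequalities in `ℕ` through `+≤-⁻`.
vacancy₁ : ∀ s ν i → vacancy s ν 𝟏 i
                     ≡ + (3 * Q i (parts (ν 𝟐))) ℤ.- + (2 * Q i (parts (ν 𝟏)))
vacancy₁ s ν i = begin
  vacancy s ν 𝟏 i
    ≡⟨ cong₂ (λ x y → + 0 ℤ.* + (i ⊓ s) ℤ.- (x ℤ.+ (y ℤ.+ + 0)))
             (∑-min (+ 2) i (ν 𝟏)) (∑-min -[1+ 2 ] i (ν 𝟐)) ⟩
  + 0 ℤ.* + (i ⊓ s) ℤ.- (+ 2 ℤ.* + q₁ ℤ.+ (-[1+ 2 ] ℤ.* + q₂ ℤ.+ + 0))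
    ≡⟨ rearrange (+ (i ⊓ s)) (+ q₁) (+ q₂) ⟩
  + 3 ℤ.* + q₂ ℤ.- + 2 ℤ.* + q₁
    ≡⟨ cong₂ ℤ._-_ (ℤ.pos-* 3 q₂) (ℤ.pos-* 2 q₁) ⟨
  + (3 * q₂) ℤ.- + (2 * q₁) ∎
  where
  open ≡-Reasoning
  q₁ = Q i (parts (ν 𝟏))
  q₂ = Q i (parts (ν 𝟐))
  rearrange : ∀ w x y → + 0 ℤ.* w ℤ.- (+ 2 ℤ.* x ℤ.+ (-[1+ 2 ] ℤ.* y ℤ.+ + 0))
                        ≡ + 3 ℤ.* y ℤ.- + 2 ℤ.* x
  rearrange = ℤ-ring

vacancy₂ : ∀ s ν i → vacancy s ν 𝟐 i
                     ≡ + (i ⊓ s + Q i (parts (ν 𝟏))) ℤ.- + (2 * Q i (parts (ν 𝟐)))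
vacancy₂ s ν i = begin
  vacancy s ν 𝟐 i
    ≡⟨ cong₂ (λ x y → + 1 ℤ.* + (i ⊓ s) ℤ.- (x ℤ.+ (y ℤ.+ + 0)))
             (∑-min -[1+ 0 ] i (ν 𝟏)) (∑-min (+ 2) i (ν 𝟐)) ⟩
  + 1 ℤ.* + (i ⊓ s) ℤ.- (-[1+ 0 ] ℤ.* + q₁ ℤ.+ (+ 2 ℤ.* + q₂ ℤ.+ + 0))
    ≡⟨ rearrange (+ (i ⊓ s)) (+ q₁) (+ q₂) ⟩
  + (i ⊓ s) ℤ.+ + q₁ ℤ.- + 2 ℤ.* + q₂
    ≡⟨ cong (λ y → + (i ⊓ s) ℤ.+ + q₁ ℤ.- y) (ℤ.pos-* 2 q₂) ⟨
  + (i ⊓ s + q₁) ℤ.- + (2 * q₂) ∎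
  where
  open ≡-Reasoning
  q₁ = Q i (parts (ν 𝟏))
  q₂ = Q i (parts (ν 𝟐))
  rearrange : ∀ w x y → + 1 ℤ.* w ℤ.- (-[1+ 0 ] ℤ.* x ℤ.+ (+ 2 ℤ.* y ℤ.+ + 0))
                        ≡ w ℤ.+ x ℤ.- + 2 ℤ.* y
  rearrange = ℤ-ring

-- Classification of the configurations

nonzero : List ℕ → List ℕ
nonzero = filter (0 <?_)

-- Sizes, `Q i` and `QQ` are all sums of functions vanishing at 0. Hence they can be computed from
-- the padded lists (a , c , c) and (b , c), with no case distinction on which rows are empty.
sum-map-nonzero : ∀ {f : ℕ → ℕ} → f 0 ≡ 0 → ∀ xs →
                  sumℕ (map f (nonzero xs)) ≡ sumℕ (map f xs)
sum-map-nonzero f0≡0 []           = refl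
sum-map-nonzero f0≡0 (zero  ∷ xs) rewrite f0≡0 = sum-map-nonzero f0≡0 xs
sum-map-nonzero {f} f0≡0 (suc x ∷ xs) = cong (_+_ (f (suc x))) (sum-map-nonzero f0≡0 xs)

Q≤*length : ∀ i xs → Q i xs ≤ i * length xs
Q≤*length i []       = z≤n
Q≤*length i (x ∷ xs) = begin
  i ⊓ x + Q i xs    ≤⟨ +-mono-≤ (m⊓n≤m i x) (Q≤*length i xs) ⟩
  i + i * length xs ≡⟨ *-suc i (length xs) ⟨
  i * suc (length xs) ∎
  where open ≤-Reasoning

Q-minimum : ∀ {i xs} → All (i ≤_) xs → Q i xs ≡ i * length xs
Q-minimum {i} []                    = sym (*-zeroʳ i)
Q-minimum {i} {_ ∷ xs} (i≤x ∷ i≤xs) =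
  trans (cong₂ _+_ (m≤n⇒m⊓n≡m i≤x) (Q-minimum i≤xs)) (sym (*-suc i (length xs)))

minimum : ∀ x xs → ∃[ i ] i ∈ x ∷ xs × All (i ≤_) (x ∷ xs)
minimum x []       = x , here refl , ≤-refl ∷ []
minimum x (y ∷ ys) with minimum y ys
... | i , i∈ , i≤ with ≤-total x i
...   | inj₁ x≤i = x , here refl , ≤-refl ∷ All.map (≤-trans x≤i) i≤
...   | inj₂ i≤x = i , there i∈ , i≤x ∷ i≤

-- The inequalities are required at parts only, because a vacancy number is known to be nonnegative
-- only where a rigging lies below it.
record Admissible (s : ℕ) (xs ys : List ℕ) : Set where
  field
    vacancy₁≥0 : ∀ {i} → i ∈ xs → 2 * Q i xs ≤ 3 * Q i ys
    vacancy₂≥0 : ∀ {i} → i ∈ ys → 2 * Q i ys ≤ i ⊓ s + Q i xs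
    positive₁  : All (0 <_) xs
    positive₂  : All (0 <_) ys

m*[n*o]≡n*[m*o] : ∀ m n o → m * (n * o) ≡ n * (m * o)
m*[n*o]≡n*[m*o] = ℕ-ring

-- Here and in length₂-bound, only the columns up to the smallest part matter.
length₁-bound : ∀ {s x xs ys} → Admissible s (x ∷ xs) ys →
                2 * length (x ∷ xs) ≤ 3 * length ys
length₁-bound {x = x} {xs} {ys} adm with minimum x xs
... | i , i∈ , i≤ = *-cancelˡ-≤ i {{>-nonZero (All.lookup positive₁ i∈)}} (begin
  i * (2 * length (x ∷ xs))  ≡⟨ m*[n*o]≡n*[m*o] i 2 (length (x ∷ xs)) ⟩
  2 * (i * length (x ∷ xs))  ≡⟨ cong (2 *_) (Q-minimum i≤) ⟨
  2 * Q i (x ∷ xs)           ≤⟨ vacancy₁≥0 i∈ ⟩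
  3 * Q i ys                 ≤⟨ *-monoʳ-≤ 3 (Q≤*length i ys) ⟩
  3 * (i * length ys)        ≡⟨ m*[n*o]≡n*[m*o] 3 i (length ys) ⟩
  i * (3 * length ys)        ∎)
  where
  open Admissible adm
  open ≤-Reasoning

length₂-bound : ∀ {s xs y ys} → Admissible s xs (y ∷ ys) →
                2 * length (y ∷ ys) ≤ 1 + length xs
length₂-bound {s} {xs} {y} {ys} adm with minimum y ys
... | i , i∈ , i≤ = *-cancelˡ-≤ i {{>-nonZero (All.lookup positive₂ i∈)}} (begin
  i * (2 * length (y ∷ ys))  ≡⟨ m*[n*o]≡n*[m*o] i 2 (length (y ∷ ys)) ⟩
  2 * (i * length (y ∷ ys))  ≡⟨ cong (2 *_) (Q-minimum i≤) ⟨
  2 * Q i (y ∷ ys)           ≤⟨ vacancy₂≥0 i∈ ⟩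
  i ⊓ s + Q i xs             ≤⟨ +-mono-≤ (m⊓n≤m i s) (Q≤*length i xs) ⟩
  i + i * length xs          ≡⟨ *-suc i (length xs) ⟨
  i * (1 + length xs)        ∎)
  where
  open Admissible adm
  open ≤-Reasoning

-- ν⁽¹⁾ = (a , c , c) and ν⁽²⁾ = (b , c), with empty rows dropped.
record Shape (s a b c : ℕ) (xs ys : List ℕ) : Set where
  field
    c≤b     : c ≤ b
    b≤a     : b ≤ a
    b≤s     : b ≤ s
    2a+c≤3b : 2 * a + c ≤ 3 * b
    rows₁   : xs ≡ nonzero (a ∷ c ∷ c ∷ [])
    rows₂   : ys ≡ nonzero (b ∷ c ∷ [])

-- The squeeze used throughout the classification: when a sum of terms must reach the total of their
-- upper bounds, no single term `u` can fall short, since the others, `v`, contribute at most `k`.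
tight : ∀ {y u v k} → v ≤ k → y + k ≤ u + v → y ≤ u
tight {y} {u} {v} {k} v≤k le = +-cancelʳ-≤ k y u (≤-trans le (+-monoʳ-≤ u v≤k))

tight-⊓ : ∀ y p q → 2 * y ≤ y ⊓ p + y ⊓ q → y ≤ p × y ≤ q
tight-⊓ y p q le =
    ≤-trans (tight {y} (m⊓n≤m y q) le′) (m⊓n≤n y p)
  , ≤-trans (tight {y} (m⊓n≤m y p) (≤-trans le′ (≤-reflexive (+-comm (y ⊓ p) _)))) (m⊓n≤n y q)
  where
  le′ : y + y ≤ y ⊓ p + y ⊓ q
  le′ = subst (λ z → y + z ≤ y ⊓ p + y ⊓ q) (+-identityʳ y) le

-- At the part b the condition is 2b ≤ b ⊓ s + b ⊓ a, so both minima equal b. Then the single row of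
-- ν⁽²⁾ lies within the first a columns, and the condition at a becomes 2a ≤ 3b.
shape-one-row : ∀ {s a b} → Admissible s (a ∷ []) (b ∷ []) →
                Shape s a b 0 (a ∷ []) (b ∷ [])
shape-one-row {s} {a} {b} adm = record
  { c≤b     = z≤n
  ; b≤a     = b≤a
  ; b≤s     = b≤s
  ; 2a+c≤3b = at-a
  ; rows₁   = parts-a (All.head positive₁)
  ; rows₂   = parts-a (All.head positive₂)
  }
  where
  open Admissible adm
  parts-a : ∀ {a zs} → 0 < a → a ∷ nonzero zs ≡ nonzero (a ∷ zs)
  parts-a {suc a} _ = refl
  at-b : b ≤ s × b ≤ a
  at-b = tight-⊓ b s a (subst₂ (λ u v → 2 * u ≤ b ⊓ s + v)
    (trans (+-identityʳ _) (⊓-idem b)) (+-identityʳ _) (vacancy₂≥0 (here refl)))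
  b≤s = proj₁ at-b
  b≤a = proj₂ at-b
  at-a : 2 * a + 0 ≤ 3 * b
  at-a = subst₂ _≤_ (trans (cong (2 *_) (trans (+-identityʳ _) (⊓-idem a))) (sym (+-identityʳ _)))
    (cong (3 *_) (trans (+-identityʳ _) (m≥n⇒m⊓n≡n b≤a))) (vacancy₁≥0 (here refl))

-- The parts are treated from the shortest upwards: a₃ and b₂ bound each other, a₂ is then forced
-- down to b₂, and once the short rows agree their contributions cancel from the conditions at b₁
-- and a₁.
shape-three-rows : ∀ {s a₁ a₂ a₃ b₁ b₂} → a₂ ≤ a₁ → a₃ ≤ a₂ → b₂ ≤ b₁ →
  Admissible s (a₁ ∷ a₂ ∷ a₃ ∷ []) (b₁ ∷ b₂ ∷ []) →
  Shape s a₁ b₁ b₂ (a₁ ∷ a₂ ∷ a₃ ∷ []) (b₁ ∷ b₂ ∷ [])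
shape-three-rows {s} {a₁} {a₂} {a₃} {b₁} {b₂} a₂≤a₁ a₃≤a₂ b₂≤b₁ adm = record
  { c≤b     = b₂≤b₁
  ; b≤a     = b₁≤a₁
  ; b≤s     = b₁≤s
  ; 2a+c≤3b = 2a+c≤3b
  ; rows₁   = trans (cong₂ (λ u v → a₁ ∷ u ∷ v ∷ []) a₂≡b₂ a₃≡b₂)
                    (sym (filter-all (0 <?_) (0<a₁ ∷ 0<b₂ ∷ 0<b₂ ∷ [])))
  ; rows₂   = sym (filter-all (0 <?_) (0<b₁ ∷ 0<b₂ ∷ []))
  }
  where
  open Admissible adm
  0<a₁ = All.head positive₁
  0<b₁ = All.head positive₂
  0<b₂ = All.head (All.tail positive₂)

  a₃≤b₂ : a₃ ≤ b₂
  a₃≤b₂ = proj₂ (tight-⊓ a₃ b₁ b₂ (*-cancelˡ-≤ 3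
    (subst₂ _≤_ eq₁ eq₂ (vacancy₁≥0 (there (there (here refl)))))))
    where
    eq₁ : 2 * Q a₃ (a₁ ∷ a₂ ∷ a₃ ∷ []) ≡ 3 * (2 * a₃)
    eq₁ rewrite m≤n⇒m⊓n≡m (≤-trans a₃≤a₂ a₂≤a₁) | m≤n⇒m⊓n≡m a₃≤a₂ | ⊓-idem a₃ = ring a₃
      where
      ring : ∀ x → 2 * (x + (x + (x + 0))) ≡ 3 * (2 * x)
      ring = ℕ-ring
    eq₂ : 3 * Q a₃ (b₁ ∷ b₂ ∷ []) ≡ 3 * (a₃ ⊓ b₁ + a₃ ⊓ b₂)
    eq₂ = cong (λ z → 3 * (a₃ ⊓ b₁ + z)) (+-identityʳ _)

  -- Here 4b₂ is at most a sum of four minima, each at most b₂, so in particular b₂ ⊓ a₃ is b₂.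
  b₂≤a₃ : b₂ ≤ a₃
  b₂≤a₃ = ≤-trans (tight {b₂} {b₂ ⊓ a₃} {b₂ ⊓ s + (b₂ ⊓ a₁ + b₂ ⊓ a₂)} {b₂ + (b₂ + b₂)}
                    (+-mono-≤ (m⊓n≤m b₂ s) (+-mono-≤ (m⊓n≤m b₂ a₁) (m⊓n≤m b₂ a₂)))
                    (subst₂ _≤_ eq₁ eq₂ (vacancy₂≥0 (there (here refl)))))
                  (m⊓n≤n b₂ a₃)
    where
    eq₁ : 2 * Q b₂ (b₁ ∷ b₂ ∷ []) ≡ b₂ + (b₂ + (b₂ + b₂))
    eq₁ rewrite m≤n⇒m⊓n≡m b₂≤b₁ | ⊓-idem b₂ = ring b₂
      where
      ring : ∀ x → 2 * (x + (x + 0)) ≡ x + (x + (x + x))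
      ring = ℕ-ring
    eq₂ : b₂ ⊓ s + Q b₂ (a₁ ∷ a₂ ∷ a₃ ∷ [])
        ≡ b₂ ⊓ a₃ + (b₂ ⊓ s + (b₂ ⊓ a₁ + b₂ ⊓ a₂))
    eq₂ = ring (b₂ ⊓ s) (b₂ ⊓ a₁) (b₂ ⊓ a₂) (b₂ ⊓ a₃)
      where
      ring : ∀ w x y z → w + (x + (y + (z + 0))) ≡ z + (w + (x + y))
      ring = ℕ-ring

  a₃≡b₂ : a₃ ≡ b₂
  a₃≡b₂ = ≤-antisym a₃≤b₂ b₂≤a₃

  -- With a₃ = b₂ the condition at a₂ gives 4a₂ + 2b₂ ≤ 3(a₂ + b₂), hence a₂ ≤ b₂.
  a₂≡b₂ : a₂ ≡ b₂
  a₂≡b₂ = ≤-antisym (tight {a₂} {b₂} {3 * a₂ + 2 * b₂} ≤-refl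
                      (subst (_≤ b₂ + (3 * a₂ + 2 * b₂)) eq (≤-trans (vacancy₁≥0 (there (here refl))) bound)))
                    (≤-trans b₂≤a₃ a₃≤a₂)
    where
    eq : 2 * Q a₂ (a₁ ∷ a₂ ∷ a₃ ∷ []) ≡ a₂ + (3 * a₂ + 2 * b₂)
    eq rewrite m≤n⇒m⊓n≡m a₂≤a₁ | ⊓-idem a₂ | m≥n⇒m⊓n≡n a₃≤a₂ | a₃≡b₂ = ring a₂ b₂
      where
      ring : ∀ x y → 2 * (x + (x + (y + 0))) ≡ x + (3 * x + 2 * y)
      ring = ℕ-ring
    bound : 3 * Q a₂ (b₁ ∷ b₂ ∷ []) ≤ b₂ + (3 * a₂ + 2 * b₂)
    bound = ≤-trans (*-monoʳ-≤ 3 (+-mono-≤ (m⊓n≤m a₂ b₁) (+-monoˡ-≤ 0 (m⊓n≤n a₂ b₂))))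
                    (≤-reflexive (ring a₂ b₂))
      where
      ring : ∀ x y → 3 * (x + (y + 0)) ≡ y + (3 * x + 2 * y)
      ring = ℕ-ring

  at-b₁ : b₁ ≤ s × b₁ ≤ a₁
  at-b₁ = tight-⊓ b₁ s a₁ (+-cancelʳ-≤ (2 * b₂) _ _ (subst₂ _≤_ eq₁ eq₂ (vacancy₂≥0 (here refl))))
    where
    eq₁ : 2 * Q b₁ (b₁ ∷ b₂ ∷ []) ≡ 2 * b₁ + 2 * b₂
    eq₁ rewrite m≥n⇒m⊓n≡n b₂≤b₁ | ⊓-idem b₁ = ring b₁ b₂
      where
      ring : ∀ x y → 2 * (x + (y + 0)) ≡ 2 * x + 2 * y
      ring = ℕ-ring
    eq₂ : b₁ ⊓ s + Q b₁ (a₁ ∷ a₂ ∷ a₃ ∷ []) ≡ b₁ ⊓ s + b₁ ⊓ a₁ + 2 * b₂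
    eq₂ rewrite a₂≡b₂ | a₃≡b₂ | m≥n⇒m⊓n≡n b₂≤b₁ = ring (b₁ ⊓ s) (b₁ ⊓ a₁) b₂
      where
      ring : ∀ w x y → w + (x + (y + (y + 0))) ≡ w + x + 2 * y
      ring = ℕ-ring
  b₁≤s  = proj₁ at-b₁
  b₁≤a₁ = proj₂ at-b₁

  2a+c≤3b : 2 * a₁ + b₂ ≤ 3 * b₁
  2a+c≤3b = +-cancelʳ-≤ (3 * b₂) _ _ (subst₂ _≤_ eq₁ eq₂ (vacancy₁≥0 (here refl)))
    where
    b₂≤a₁ = ≤-trans b₂≤b₁ b₁≤a₁
    eq₁ : 2 * Q a₁ (a₁ ∷ a₂ ∷ a₃ ∷ []) ≡ 2 * a₁ + b₂ + 3 * b₂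
    eq₁ rewrite a₂≡b₂ | a₃≡b₂ | ⊓-idem a₁ | m≥n⇒m⊓n≡n b₂≤a₁ = ring a₁ b₂
      where
      ring : ∀ x y → 2 * (x + (y + (y + 0))) ≡ 2 * x + y + 3 * y
      ring = ℕ-ring
    eq₂ : 3 * Q a₁ (b₁ ∷ b₂ ∷ []) ≡ 3 * b₁ + 3 * b₂
    eq₂ rewrite m≥n⇒m⊓n≡n b₁≤a₁ | m≥n⇒m⊓n≡n b₂≤a₁ = ring b₁ b₂
      where
      ring : ∀ x y → 3 * (x + (y + 0)) ≡ 3 * x + 3 * y
      ring = ℕ-ring

-- Eliminating p gives 4q ≤ 2 + 2p ≤ 2 + 3q, so q ≤ 2. The value q = 0 contradicts 0 < p, and for q
-- = 1 and q = 2 the bounds leave one integer p each.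
lengths : ∀ p q → 0 < p → 2 * p ≤ 3 * q → 2 * q ≤ 1 + p →
          (p ≡ 1 × q ≡ 1) ⊎ (p ≡ 3 × q ≡ 2)
lengths p 0 0<p le₁ _ = contradiction (*-cancelˡ-≤ {p} {0} 2 le₁) (<⇒≱ 0<p)
lengths p 1 0<p le₁ _ = inj₁ (≤-antisym (≤-pred (*-cancelˡ-< 2 p 2 (s≤s le₁))) 0<p , refl)
lengths p 2 _ le₁ le₂ =
  inj₂ (≤-antisym (≤-pred (*-cancelˡ-< 2 p 4 (≤-<-trans le₁ (n≤1+n 7)))) (≤-pred le₂) , refl)
lengths p q@(suc (suc (suc _))) _ le₁ le₂ = contradiction
  (+-cancelʳ-≤ (3 * q) q 2 (begin
    q + 3 * q        ≡⟨ double q ⟩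
    2 * (2 * q)      ≤⟨ *-monoʳ-≤ 2 le₂ ⟩
    2 * (1 + p)      ≡⟨ *-distribˡ-+ 2 1 p ⟩
    2 + 2 * p        ≤⟨ +-monoʳ-≤ 2 le₁ ⟩
    2 + 3 * q        ∎))
  (λ { (s≤s (s≤s ())) })
  where
  open ≤-Reasoning
  double : ∀ q → q + 3 * q ≡ 2 * (2 * q)
  double = ℕ-ring

classify-shape : ∀ {s} xs ys → Linked _≥_ xs → Linked _≥_ ys →
                 Admissible s xs ys → ∃[ a ] ∃[ b ] ∃[ c ] Shape s a b c xs ys
classify-shape [] [] _ _ _ = 0 , 0 , 0 , record
  { c≤b = z≤n ; b≤a = z≤n ; b≤s = z≤n ; 2a+c≤3b = z≤n ; rows₁ = refl ; rows₂ = refl }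
classify-shape [] (_ ∷ ys) _ _ adm =
  contradiction (*-cancelˡ-< 2 (suc (length ys)) 1 (s≤s (length₂-bound adm))) λ { (s≤s ()) }
classify-shape (x ∷ xs) [] _ _ adm =
  contradiction (*-cancelˡ-≤ {suc (length xs)} {0} 2 (length₁-bound adm)) λ ()
classify-shape (x ∷ xs) (y ∷ ys) dec₁ dec₂ adm =
  go xs ys dec₁ dec₂ adm (lengths _ _ z<s (length₁-bound adm) (length₂-bound adm))
  where
  go : ∀ xs ys → Linked _≥_ (x ∷ xs) → Linked _≥_ (y ∷ ys) →
       Admissible _ (x ∷ xs) (y ∷ ys) →
       (suc (length xs) ≡ 1 × suc (length ys) ≡ 1) ⊎
       (suc (length xs) ≡ 3 × suc (length ys) ≡ 2) →
       ∃[ a ] ∃[ b ] ∃[ c ] Shape _ a b c (x ∷ xs) (y ∷ ys)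
  go [] [] _ _ adm (inj₁ _) = x , y , 0 , shape-one-row adm
  go (_ ∷ _ ∷ []) (y′ ∷ []) (le₁ ∷ le₂ ∷ _) (le₃ ∷ _) adm (inj₂ _) =
    x , y , y′ , shape-three-rows le₁ le₂ le₃ adm

-- Rigged configurations of a given shape

+≤- : ∀ {k} m n → m + n ≤ k → + m ℤ.≤ + k ℤ.- + n
+≤- {k} m n le = subst (ℤ._≤ + k ℤ.- + n) (ring (+ m) (+ n)) (ℤ.+-monoˡ-≤ (ℤ.- + n) (ℤ.+≤+ le))
  where
  ring : ∀ m n → m ℤ.+ n ℤ.- n ≡ m
  ring = ℤ-ring

+≤-⁻ : ∀ {k} m n → + m ℤ.≤ + k ℤ.- + n → m + n ≤ k
+≤-⁻ {k} m n le = ℤ.drop‿+≤+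
  (subst (ℤ._≤_ (+ (m + n))) (ring (+ k) (+ n)) (ℤ.+-monoˡ-≤ (+ n) le))
  where
  ring : ∀ k n → k ℤ.- n ℤ.+ n ≡ k
  ring = ℤ-ring

∈-nonzero⁻ : ∀ {i xs} → i ∈ nonzero xs → i ∈ xs
∈-nonzero⁻ = proj₁ ∘ ∈-filter⁻ (0 <?_)

-- Equality of lengths is the only link between riggings and parts. Here and in `rigging⇒part` it is
-- used as a transfer of nonemptiness between `J R a i` and the list of parts equal to `i`.
part⇒rigging : ∀ {s} (R : RCᴴᵂ s) a {i} → i ∈ parts (ν R a) → ∃[ x ] x ∈ J R a i
part⇒rigging R a {i} i∈ = go (J R a i) (J-length R a i) (∈-filter⁺ (_≟ i) i∈ refl)
  where
  go : ∀ (xs : List ℤ) {zs : List ℕ} → length xs ≡ length zs → i ∈ zs → ∃[ x ] x ∈ xs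
  go (x ∷ _) _  _        = x , here refl
  go []      () (here _)
  go []      () (there _)

rigging⇒part : ∀ {s} (R : RCᴴᵂ s) a {i x} → x ∈ J R a i → i ∈ parts (ν R a)
rigging⇒part R a {i} x∈ = go (J-length R a i) x∈ (∈-filter⁻ (_≟ i))
  where
  go : ∀ {xs : List ℤ} {x zs} {P : ℕ → Set} → length xs ≡ length zs → x ∈ xs →
       (∀ {z} → z ∈ zs → P z × z ≡ i) → P i
  go {zs = z ∷ zs} _ _ h with h (here refl)
  ... | p , refl = p
  go {zs = []} () (here _)
  go {zs = []} () (there _)

admissible : ∀ {s} (R : RCᴴᵂ s) → Admissible s (parts (ν R 𝟏)) (parts (ν R 𝟐))
admissible {s} R = record
  { vacancy₁≥0 = λ {i} i∈ →
      +≤-⁻ 0 _ (subst (ℤ._≤_ (+ 0)) (vacancy₁ s (ν R) i) (vacancy≥0 𝟏 i∈))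
  ; vacancy₂≥0 = λ {i} i∈ →
      +≤-⁻ 0 _ (subst (ℤ._≤_ (+ 0)) (vacancy₂ s (ν R) i) (vacancy≥0 𝟐 i∈))
  ; positive₁  = positive (ν R 𝟏)
  ; positive₂  = positive (ν R 𝟐)
  }
  where
  vacancy≥0 : ∀ a {i} → i ∈ parts (ν R a) → + 0 ℤ.≤ vacancy s (ν R) a i
  vacancy≥0 a {i} i∈ with x , x∈ ← part⇒rigging R a i∈
                     with 0≤x , x≤p ← All.lookup (J-bounds R a i) x∈ = ℤ.≤-trans 0≤x x≤p

Q-zero : ∀ xs → Q 0 xs ≡ 0
Q-zero xs = n≤0⇒n≡0 (Q≤*length 0 xs)

ShapeOf : ∀ s a b c → Configuration → Set
ShapeOf s a b c ν = Shape s a b c (parts (ν 𝟏)) (parts (ν 𝟐))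

module _ {s a b c ν} (shape : ShapeOf s a b c ν) where
  open Shape shape
  open ≡-Reasoning

  c≤a : c ≤ a
  c≤a = ≤-trans c≤b b≤a

  sum₁ : ∀ {f : ℕ → ℕ} → f 0 ≡ 0 → sumℕ (map f (parts (ν 𝟏))) ≡ f a + (f c + f c)
  sum₁ {f} f0≡0 = begin
    sumℕ (map f (parts (ν 𝟏)))               ≡⟨ cong (sumℕ ∘ map f) rows₁ ⟩
    sumℕ (map f (nonzero (a ∷ c ∷ c ∷ [])))  ≡⟨ sum-map-nonzero f0≡0 (a ∷ c ∷ c ∷ []) ⟩
    f a + (f c + (f c + 0))                  ≡⟨ cong (λ z → f a + (f c + z)) (+-identityʳ _) ⟩
    f a + (f c + f c)                        ∎

  sum₂ : ∀ {f : ℕ → ℕ} → f 0 ≡ 0 → sumℕ (map f (parts (ν 𝟐))) ≡ f b + f c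
  sum₂ {f} f0≡0 = begin
    sumℕ (map f (parts (ν 𝟐)))           ≡⟨ cong (sumℕ ∘ map f) rows₂ ⟩
    sumℕ (map f (nonzero (b ∷ c ∷ [])))  ≡⟨ sum-map-nonzero f0≡0 (b ∷ c ∷ []) ⟩
    f b + (f c + 0)                      ≡⟨ cong (_+_ (f b)) (+-identityʳ _) ⟩
    f b + f c                            ∎

  Q₁ : ∀ {i} → c ≤ i → i ≤ a → Q i (parts (ν 𝟏)) ≡ i + (c + c)
  Q₁ {i} c≤i i≤a = trans (sum₁ (⊓-zeroʳ i))
    (cong₂ (λ x y → x + (y + y)) (m≤n⇒m⊓n≡m i≤a) (m≥n⇒m⊓n≡n c≤i))

  Q₂ : ∀ {i} → c ≤ i → i ≤ b → Q i (parts (ν 𝟐)) ≡ i + c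
  Q₂ {i} c≤i i≤b = trans (sum₂ (⊓-zeroʳ i)) (cong₂ _+_ (m≤n⇒m⊓n≡m i≤b) (m≥n⇒m⊓n≡n c≤i))

  Q₂-beyond : ∀ {i} → b ≤ i → Q i (parts (ν 𝟐)) ≡ b + c
  Q₂-beyond {i} b≤i = trans (sum₂ (⊓-zeroʳ i))
    (cong₂ _+_ (m≥n⇒m⊓n≡n b≤i) (m≥n⇒m⊓n≡n (≤-trans c≤b b≤i)))

  size₁ : ∣ ν 𝟏 ∣ₚ ≡ a + (c + c)
  size₁ = trans (cong sumℕ (sym (map-id (parts (ν 𝟏))))) (sum₁ refl)

  size₂ : ∣ ν 𝟐 ∣ₚ ≡ b + c
  size₂ = trans (cong sumℕ (sym (map-id (parts (ν 𝟐))))) (sum₂ refl)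

  QQ₁₁ : QQ (parts (ν 𝟏)) (parts (ν 𝟏)) ≡ a + (c + c) + (c + (c + c) + (c + (c + c)))
  QQ₁₁ = trans (sum₁ (Q-zero (parts (ν 𝟏))))
    (cong₂ (λ x y → x + (y + y)) (Q₁ c≤a ≤-refl) (Q₁ ≤-refl c≤a))

  QQ₁₂ : QQ (parts (ν 𝟏)) (parts (ν 𝟐)) ≡ b + c + (c + c + (c + c))
  QQ₁₂ = trans (sum₁ (Q-zero (parts (ν 𝟐))))
    (cong₂ (λ x y → x + (y + y)) (Q₂-beyond b≤a) (Q₂ ≤-refl c≤b))

  QQ₂₁ : QQ (parts (ν 𝟐)) (parts (ν 𝟏)) ≡ b + (c + c) + (c + (c + c))
  QQ₂₁ = trans (sum₂ (Q-zero (parts (ν 𝟏)))) (cong₂ _+_ (Q₁ c≤b b≤a) (Q₁ ≤-refl c≤a))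

  QQ₂₂ : QQ (parts (ν 𝟐)) (parts (ν 𝟐)) ≡ b + c + (c + c)
  QQ₂₂ = trans (sum₂ (Q-zero (parts (ν 𝟐)))) (cong₂ _+_ (Q₂ c≤b ≤-refl) (Q₂ ≤-refl c≤b))

  -- No row is longer than a, so `Q a` counts every cell, and the value coincides with the
  -- `Λ̄₁`-coordinate of the weight.
  vacancy₁-a : vacancy s ν 𝟏 a ≡ + (3 * b) ℤ.- + (2 * a + c)
  vacancy₁-a = begin
    vacancy s ν 𝟏 a
      ≡⟨ vacancy₁ s ν a ⟩
    + (3 * Q a (parts (ν 𝟐))) ℤ.- + (2 * Q a (parts (ν 𝟏)))
      ≡⟨ cong₂ (λ x y → + (3 * x) ℤ.- + (2 * y)) (Q₂-beyond b≤a) (Q₁ c≤a ≤-refl) ⟩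
    + (3 * (b + c)) ℤ.- + (2 * (a + (c + c)))
      ≡⟨ cong₂ (λ x y → + x ℤ.- + y) (ring₁ b c) (ring₂ a c) ⟩
    + (3 * b + 3 * c) ℤ.- + (2 * a + c + 3 * c)
      ≡⟨ cancel (+ (3 * b)) (+ (2 * a + c)) (+ (3 * c)) ⟩
    + (3 * b) ℤ.- + (2 * a + c) ∎
    where
    ring₁ : ∀ b c → 3 * (b + c) ≡ 3 * b + 3 * c
    ring₁ = ℕ-ring
    ring₂ : ∀ a c → 2 * (a + (c + c)) ≡ 2 * a + c + 3 * c
    ring₂ = ℕ-ring
    cancel : ∀ x y z → (x ℤ.+ z) ℤ.- (y ℤ.+ z) ≡ x ℤ.- y
    cancel = ℤ-ring

  vacancy₁-c : vacancy s ν 𝟏 c ≡ + 0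
  vacancy₁-c = trans (vacancy₁ s ν c) (ℤ.i≡j⇒i-j≡0 (cong +_ (begin
    3 * Q c (parts (ν 𝟐))  ≡⟨ cong (3 *_) (Q₂ ≤-refl c≤b) ⟩
    3 * (c + c)            ≡⟨ ring c ⟩
    2 * (c + (c + c))      ≡⟨ cong (2 *_) (Q₁ ≤-refl c≤a) ⟨
    2 * Q c (parts (ν 𝟏))  ∎)))
    where
    ring : ∀ c → 3 * (c + c) ≡ 2 * (c + (c + c))
    ring = ℕ-ring

  vacancy₂-zero : ∀ {i} → c ≤ i → i ≤ b → vacancy s ν 𝟐 i ≡ + 0
  vacancy₂-zero {i} c≤i i≤b = trans (vacancy₂ s ν i) (ℤ.i≡j⇒i-j≡0 (cong +_ (begin
    i ⊓ s + Q i (parts (ν 𝟏))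
      ≡⟨ cong₂ _+_ (m≤n⇒m⊓n≡m (≤-trans i≤b b≤s)) (Q₁ c≤i (≤-trans i≤b b≤a)) ⟩
    i + (i + (c + c))          ≡⟨ ring i c ⟩
    2 * (i + c)                ≡⟨ cong (2 *_) (Q₂ c≤i i≤b) ⟨
    2 * Q i (parts (ν 𝟐))      ∎)))
    where
    ring : ∀ i c → i + (i + (c + c)) ≡ 2 * (i + c)
    ring = ℕ-ring

  part₁ : ∀ {i} → i ∈ parts (ν 𝟏) → i ≡ a ⊎ i ≡ c
  part₁ {i} i∈ with ∈-nonzero⁻ {xs = a ∷ c ∷ c ∷ []} (subst (i ∈_) rows₁ i∈)
  ... | here eq                 = inj₁ eq
  ... | there (here eq)         = inj₂ eq
  ... | there (there (here eq)) = inj₂ eq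

  vacancy₂≡0 : ∀ {i} → i ∈ parts (ν 𝟐) → vacancy s ν 𝟐 i ≡ + 0
  vacancy₂≡0 {i} i∈ with ∈-nonzero⁻ {xs = b ∷ c ∷ []} (subst (i ∈_) rows₂ i∈)
  ... | here refl         = vacancy₂-zero c≤b ≤-refl
  ... | there (here refl) = vacancy₂-zero ≤-refl c≤b

  mult₁-a : a ≢ c → mult a (ν 𝟏) ≡ 1
  mult₁-a a≢c = trans (cong (length ∘ filter (_≟ a)) rows₁) (go a c≤a a≢c)
    where
    go : ∀ a → c ≤ a → a ≢ c → length (filter (_≟ a) (nonzero (a ∷ c ∷ c ∷ []))) ≡ 1
    go zero    c≤0 a≢c = contradiction (sym (n≤0⇒n≡0 c≤0)) a≢c
    go a@(suc _) _ a≢c = begin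
      length (filter (_≟ a) (a ∷ nonzero (c ∷ c ∷ [])))
        ≡⟨ cong length (filter-accept (_≟ a) refl) ⟩
      suc (length (filter (_≟ a) (nonzero (c ∷ c ∷ []))))
        ≡⟨ cong (suc ∘ length) (filter-none (_≟ a) (All.filter⁺ (0 <?_) (≢-sym a≢c ∷ ≢-sym a≢c ∷ []))) ⟩
      1 ∎

-- The default is the right value of x: the list at the row a is empty exactly when a = 0, and then
-- 3b - 2a - c is 0 as well.
headOr0 : List ℤ → ℤ
headOr0 []      = + 0
headOr0 (x ∷ _) = x

zeros-unique : ∀ {xs ys : List ℤ} → length xs ≡ length ys →
               All (_≡ + 0) xs → All (_≡ + 0) ys → xs ≡ ys
zeros-unique {[]}    {[]}    _  _           _           = refl
zeros-unique {_ ∷ _} {_ ∷ _} eq (refl ∷ ps) (refl ∷ qs) =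
  cong (_ ∷_) (zeros-unique (suc-injective eq) ps qs)

singleton-unique : ∀ {xs ys : List ℤ} → length xs ≡ 1 → length ys ≡ 1 →
                   headOr0 xs ≡ headOr0 ys → xs ≡ ys
singleton-unique {_ ∷ []} {_ ∷ []} _ _ = cong (_∷ [])

zero-riggings : ∀ {s} (R : RCᴴᵂ s) α {i} →
                (i ∈ parts (ν R α) → vacancy s (ν R) α i ≡ + 0) →
                All (_≡ + 0) (J R α i)
zero-riggings R α {i} vac≡0 = All.tabulate λ x∈ →
  let 0≤x , x≤p = All.lookup (J-bounds R α i) x∈
  in ℤ.≤-antisym (subst (ℤ._≤_ _) (vac≡0 (rigging⇒part R α x∈)) x≤p) 0≤x

-- Only the rigging of the longest row of ν⁽¹⁾ is free.
riggings-unique : ∀ {s a b c} (R R′ : RCᴴᵂ s) →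
  ShapeOf s a b c (ν R) → ShapeOf s a b c (ν R′) →
  headOr0 (J R 𝟏 a) ≡ headOr0 (J R′ 𝟏 a) → ∀ α i → J R α i ≡ J R′ α i
riggings-unique {s} {a} {b} {c} R R′ sh sh′ heads = unique
  where
  module S = Shape sh
  module S′ = Shape sh′
  lengths-agree : ∀ α i → length (J R α i) ≡ length (J R′ α i)
  lengths-agree α i = trans (J-length R α i)
    (trans (cong (length ∘ filter (_≟ i)) (parts-agree α)) (sym (J-length R′ α i)))
    where
    parts-agree : ∀ α → parts (ν R α) ≡ parts (ν R′ α)
    parts-agree 𝟏 = trans S.rows₁ (sym S′.rows₁)
    parts-agree 𝟐 = trans S.rows₂ (sym S′.rows₂)
  zero₁ : ∀ (R : RCᴴᵂ s) → ShapeOf s a b c (ν R) → ∀ {i} → (i ≡ a → a ≡ c) →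
          All (_≡ + 0) (J R 𝟏 i)
  zero₁ R sh {i} h = zero-riggings R 𝟏 λ i∈ →
    subst (λ k → vacancy s (ν R) 𝟏 k ≡ + 0) (sym (i≡c (part₁ {ν = ν R} sh i∈)))
          (vacancy₁-c {ν = ν R} sh)
    where
    i≡c : i ≡ a ⊎ i ≡ c → i ≡ c
    i≡c (inj₁ i≡a) = trans i≡a (h i≡a)
    i≡c (inj₂ eq)  = eq
  unique : ∀ α i → J R α i ≡ J R′ α i
  unique 𝟐 i = zeros-unique (lengths-agree 𝟐 i)
    (zero-riggings R 𝟐 (vacancy₂≡0 {ν = ν R} sh))
    (zero-riggings R′ 𝟐 (vacancy₂≡0 {ν = ν R′} sh′))
  -- When a = c the row a is not distinguished from the others and may share its list with them, but
  -- its vacancy number is then that of c, namely zero. Only when a ≠ c is there a single, free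
  -- rigging.
  unique 𝟏 i with i ≟ a | a ≟ c
  ... | no  i≢a  | _       = zeros-unique (lengths-agree 𝟏 i)
    (zero₁ R sh (λ i≡a → contradiction i≡a i≢a)) (zero₁ R′ sh′ (λ i≡a → contradiction i≡a i≢a))
  ... | yes _    | yes a≡c = zeros-unique (lengths-agree 𝟏 i)
    (zero₁ R sh (λ _ → a≡c)) (zero₁ R′ sh′ (λ _ → a≡c))
  ... | yes refl | no  a≢c = singleton-unique
    (trans (J-length R 𝟏 a) (mult₁-a {ν = ν R} sh a≢c))
    (trans (J-length R′ 𝟏 a) (mult₁-a {ν = ν R′} sh′ a≢c))
    heads

-- Normalisation of fractions blocks computation with variables in `ℚ`. Over the unnormalised
-- rationals the equation is the cross-multiplied integer identity `ring`.
half-double+ : ∀ n w → ℚ.½ ℚ.* ((+ 2 ℤ.* n) /1) ℚ.+ w /1 ≡ (n ℤ.+ w) /1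
half-double+ n w = toℚᵘ-injective
  (≃-trans (toℚᵘ-homo-+ (ℚ.½ ℚ.* ((+ 2 ℤ.* n) /1)) (w /1))
  (≃-trans (+-cong (≃-trans (toℚᵘ-homo-* ℚ.½ ((+ 2 ℤ.* n) /1))
                            (*-cong (ℚᵘ.≃-refl {ℚᵘ.½}) (toℚᵘ-fromℚᵘ (mkℚᵘ (+ 2 ℤ.* n) 0))))
                   (toℚᵘ-fromℚᵘ (mkℚᵘ w 0)))
  (≃-trans (*≡* (ring n w)) (≃-sym (toℚᵘ-fromℚᵘ (mkℚᵘ (n ℤ.+ w) 0))))))
  where
  ring : ∀ n w → (+ 1 ℤ.* (+ 2 ℤ.* n) ℤ.* + 1 ℤ.+ w ℤ.* + 2) ℤ.* + 1 ≡ (n ℤ.+ w) ℤ.* + 2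
  ring = ℤ-ring

-- Partitions and riggings read off a list of rows

filter-map : ∀ {P : Pred Y 0ℓ} (P? : Decidable P) (f : X → Y) xs →
             filter P? (map f xs) ≡ map f (filter (P? ∘ f) xs)
filter-map P? f []       = refl
filter-map P? f (x ∷ xs) with does (P? (f x))
... | true  = cong (f x ∷_) (filter-map P? f xs)
... | false = filter-map P? f xs

-- A row of length i with rigging x is the pair (i , x).
Row : Set
Row = ℕ × ℤ

nonzeroRows : List Row → List Row
nonzeroRows = filter (λ p → 0 <? proj₁ p)

-- Riggings and parts come from one list of rows, so their numbers agree automatically. Discarding
-- empty rows first makes the list at 0 empty.
riggingsAt : ℕ → List Row → List ℤ
riggingsAt i rows = map proj₂ (filter (λ p → proj₁ p ≟ i) (nonzeroRows rows))

rowPartition : (rows : List Row) → Linked (_≥_ on proj₁) rows → Partition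
rowPartition rows dec = record
  { parts      = map proj₁ (nonzeroRows rows)
  ; positive   = All.map⁺ (all-filter (λ p → 0 <? proj₁ p) rows)
  ; decreasing = Linked.map⁺ (Linked.filter⁺ (λ p → 0 <? proj₁ p)
                   (λ {i} {j} {k} i≥j j≥k → ≤-trans j≥k i≥j) dec)
  }

length-riggingsAt : ∀ i rows → length (riggingsAt i rows) ≡
                    length (filter (_≟ i) (map proj₁ (nonzeroRows rows)))
length-riggingsAt i rows = begin
  length (map proj₂ rowsᵢ)  ≡⟨ length-map proj₂ rowsᵢ ⟩
  length rowsᵢ              ≡⟨ length-map proj₁ rowsᵢ ⟨
  length (map proj₁ rowsᵢ)  ≡⟨ cong length (filter-map (_≟ i) proj₁ (nonzeroRows rows)) ⟨
  length (filter (_≟ i) (map proj₁ (nonzeroRows rows))) ∎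
  where
  open ≡-Reasoning
  rowsᵢ : List Row
  rowsᵢ = filter (λ p → proj₁ p ≟ i) (nonzeroRows rows)

All-riggingsAt : ∀ {P : ℕ → ℤ → Set} i {rows} → All (λ p → P (proj₁ p) (proj₂ p)) rows →
                 All (P i) (riggingsAt i rows)
All-riggingsAt {P} i {rows} ps = All.map⁺ (All.zipWith (λ { (refl , p) → p })
  ( all-filter (λ p → proj₁ p ≟ i) (nonzeroRows rows)
  , All.filter⁺ (λ p → proj₁ p ≟ i) (All.filter⁺ (λ p → 0 <? proj₁ p) ps)))

sum-nonzeroRows : ∀ {rows} → All (λ p → proj₁ p ≡ 0 → proj₂ p ≡ + 0) rows →
                  sumℤ (map proj₂ (nonzeroRows rows)) ≡ sumℤ (map proj₂ rows)
sum-nonzeroRows []                             = refl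
sum-nonzeroRows {(zero  , x) ∷ rows} (h ∷ hs) rewrite h refl =
  trans (sum-nonzeroRows hs) (sym (ℤ.+-identityˡ _))
sum-nonzeroRows {(suc _ , x) ∷ rows} (h ∷ hs) = cong (ℤ._+_ x) (sum-nonzeroRows hs)

totalRigging : ∀ {s} → RCᴴᵂ s → I₀ → ℤ
totalRigging R α = ∑[1⋯ ∣ ν R α ∣ₚ ] (λ i → sumℤ (J R α i))

∑-riggingsAt : ∀ rows dec → All (λ p → proj₁ p ≡ 0 → proj₂ p ≡ + 0) rows →
  ∑[1⋯ ∣ rowPartition rows dec ∣ₚ ] (λ i → sumℤ (riggingsAt i rows)) ≡ sumℤ (map proj₂ rows)
∑-riggingsAt rows dec h = trans
  (∑-fibres ∣ rowPartition rows dec ∣ₚ proj₁ proj₂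
    (All.map⁻ (parts-bounded (rowPartition rows dec))))
  (sum-nonzeroRows h)

-- Cocharge and weight: invariance under equivalence and values on a shape

totalRigging-cong : ∀ {s} {R R′ : RCᴴᵂ s} → R ≈ᴿᶜ R′ →
                    ∀ α → totalRigging R α ≡ totalRigging R′ α
totalRigging-cong {R = R} {R′} (p , q) α = trans
  (∑-cong ∣ ν R α ∣ₚ (λ i →
    foldr-commMonoid (setoid ℤ) ℤ.+-0-isCommutativeMonoid (↭⇒↭ₛ (q α i))))
  (cong (λ xs → ∑[1⋯ sumℕ xs ] (λ i → sumℤ (J R′ α i))) (p α))

-- The trailing `+ 0` terms are those left by unfolding `∑I₀`; with them in place, `cc≡ccFormula`
-- needs nothing beyond `∑∑-min`.
quadraticForm : List ℕ → List ℕ → ℤ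
quadraticForm xs ys =
  (+ 2 ⊠ + QQ xs xs ⊞ (-[1+ 2 ] ⊠ + QQ xs ys ⊞ + 0)) ⊞
  ((-[1+ 2 ] ⊠ + QQ ys xs ⊞ (+ 6 ⊠ + QQ ys ys ⊞ + 0)) ⊞ + 0)

ccFormula : ℤ → ℤ → ℤ → ℚ
ccFormula q x₁ x₂ = ℚ.½ ℚ.* q /1 ℚ.+ (+ 1 ⊠ x₁ ⊞ (+ 3 ⊠ x₂ ⊞ + 0)) /1

cc≡ccFormula : ∀ {s} (R : RCᴴᵂ s) →
  cc R ≡ ccFormula (quadraticForm (parts (ν R 𝟏)) (parts (ν R 𝟐)))
                   (totalRigging R 𝟏) (totalRigging R 𝟐)
cc≡ccFormula R =
  cong (λ q → ccFormula q (totalRigging R 𝟏) (totalRigging R 𝟐))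
    (cong₂ (λ x y → x ⊞ (y ⊞ + 0))
      (cong₂ (λ x y → x ⊞ (y ⊞ + 0)) (∑∑-min (+ 2) (ν R 𝟏) (ν R 𝟏))
                                     (∑∑-min -[1+ 2 ] (ν R 𝟏) (ν R 𝟐)))
      (cong₂ (λ x y → x ⊞ (y ⊞ + 0)) (∑∑-min -[1+ 2 ] (ν R 𝟐) (ν R 𝟏))
                                     (∑∑-min (+ 6) (ν R 𝟐) (ν R 𝟐))))

cc-cong : ∀ {s} {R R′ : RCᴴᵂ s} → R ≈ᴿᶜ R′ → cc R ≡ cc R′
cc-cong {R = R} {R′} R≈R′@(p , _) = begin
  cc R
    ≡⟨ cc≡ccFormula R ⟩
  ccFormula q (totalRigging R 𝟏) (totalRigging R 𝟐)
    ≡⟨ cong₂ (ccFormula q) (totals 𝟏) (totals 𝟐) ⟩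
  ccFormula q (totalRigging R′ 𝟏) (totalRigging R′ 𝟐)
    ≡⟨ cong (λ z → ccFormula z (totalRigging R′ 𝟏) (totalRigging R′ 𝟐))
            (cong₂ quadraticForm (p 𝟏) (p 𝟐)) ⟩
  ccFormula q′ (totalRigging R′ 𝟏) (totalRigging R′ 𝟐)
    ≡⟨ cc≡ccFormula R′ ⟨
  cc R′ ∎
  where
  open ≡-Reasoning
  q q′ : ℤ
  q  = quadraticForm (parts (ν R 𝟏)) (parts (ν R 𝟐))
  q′ = quadraticForm (parts (ν R′ 𝟏)) (parts (ν R′ 𝟐))
  totals : ∀ α → totalRigging R α ≡ totalRigging R′ α
  totals = totalRigging-cong {R = R} {R′} R≈R′

wt-cong : ∀ {s} {R R′ : RCᴴᵂ s} → R ≈ᴿᶜ R′ → wtRC R ≡ wtRC R′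
wt-cong {s} (p , _) =
  cong₂ (λ xs ys → (+ s) · Λ̄₂ ⊖ (+ sumℕ xs) · ᾱ₁ ⊖ (+ sumℕ ys) · ᾱ₂) (p 𝟏) (p 𝟐)

-- The mixed terms contribute -3b each and cancel the 6b from ν⁽²⁾ paired with itself, so b affects
-- the cocharge only through the range of x.
quadraticForm-shape : ∀ {s a b c ν} → ShapeOf s a b c ν →
  quadraticForm (parts (ν 𝟏)) (parts (ν 𝟐)) ≡ + 2 ℤ.* + (a + (c + c))
quadraticForm-shape {a = a} {b} {c} {ν} sh
  rewrite QQ₁₁ {ν = ν} sh | QQ₁₂ {ν = ν} sh | QQ₂₁ {ν = ν} sh | QQ₂₂ {ν = ν} sh =
  ring (+ a) (+ b) (+ c)
  where
  ring : ∀ a b c →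
    (+ 2 ⊠ (a ⊞ (c ⊞ c) ⊞ (c ⊞ (c ⊞ c) ⊞ (c ⊞ (c ⊞ c)))) ⊞
      (-[1+ 2 ] ⊠ (b ⊞ c ⊞ (c ⊞ c ⊞ (c ⊞ c))) ⊞ + 0)) ⊞
    ((-[1+ 2 ] ⊠ (b ⊞ (c ⊞ c) ⊞ (c ⊞ (c ⊞ c))) ⊞ (+ 6 ⊠ (b ⊞ c ⊞ (c ⊞ c)) ⊞ + 0)) ⊞ + 0)
    ≡ + 2 ⊠ (a ⊞ (c ⊞ c))
  ring = ℤ-ring

wt-shape : ∀ {s a b c ν} → ShapeOf s a b c ν → wtConf s ν ≡
  ( + (3 * (b + c)) ℤ.- + (2 * (a + (c + c)))
  , + (s + (a + (c + c))) ℤ.- + (2 * (b + c)) )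
wt-shape {s} {a} {b} {c} {ν} sh = trans
  (cong₂ (λ m n → (+ s) · Λ̄₂ ⊖ (+ m) · ᾱ₁ ⊖ (+ n) · ᾱ₂) (size₁ {ν = ν} sh) (size₂ {ν = ν} sh))
  (cong₂ _,_
    (trans (ring₁ (+ s) (+ (a + (c + c))) (+ (b + c)))
           (sym (cong₂ ℤ._-_ (ℤ.pos-* 3 (b + c)) (ℤ.pos-* 2 (a + (c + c))))))
    (trans (ring₂ (+ s) (+ (a + (c + c))) (+ (b + c)))
           (sym (cong (ℤ._-_ (+ (s + (a + (c + c))))) (ℤ.pos-* 2 (b + c))))))
  where
  ring₁ : ∀ s m n → s ℤ.* + 0 ℤ.- m ℤ.* + 2 ℤ.- n ℤ.* -[1+ 2 ] ≡ + 3 ℤ.* n ℤ.- + 2 ℤ.* m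
  ring₁ = ℤ-ring
  ring₂ : ∀ s m n → s ℤ.* + 1 ℤ.- m ℤ.* -[1+ 0 ] ℤ.- n ℤ.* + 2 ≡ s ℤ.+ m ℤ.- + 2 ℤ.* n
  ring₂ = ℤ-ring

-- The coordinates of the weight are 3b - 2a - c and (s - b) + (a - b).
dominant-shape : ∀ {s a b c ν} → ShapeOf s a b c ν → Dominant (wtConf s ν)
dominant-shape {s} {a} {b} {c} {ν} sh = subst Dominant (sym (wt-shape {ν = ν} sh))
  ( +≤- 0 _ (subst₂ _≤_ (ring₁ a c) (ring₂ b c) (+-monoˡ-≤ (3 * c) 2a+c≤3b))
  , +≤- 0 _ (subst₂ _≤_ (ring₃ b c) (ring₄ s a c) (+-monoˡ-≤ (c + c) (+-mono-≤ b≤s b≤a))))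
  where
  open Shape sh
  ring₁ : ∀ a c → 2 * a + c + 3 * c ≡ 2 * (a + (c + c))
  ring₁ = ℕ-ring
  ring₂ : ∀ b c → 3 * b + 3 * c ≡ 3 * (b + c)
  ring₂ = ℕ-ring
  ring₃ : ∀ b c → b + b + (c + c) ≡ 2 * (b + c)
  ring₃ = ℕ-ring
  ring₄ : ∀ s a c → s + a + (c + c) ≡ s + (a + (c + c))
  ring₄ = ℕ-ring

-- The rigged configuration of an index

module _ {s : ℕ} (r : 𝒜 s) where
  open 𝒜 r

  rowC rowB rowA : ℕ
  rowC = r₄
  rowB = r₄ + (r₁ + r₂ + r₃)
  rowA = rowB + r₃

  rows : I₀ → List Row
  rows 𝟏 = (rowA , + r₂) ∷ (rowC , + 0) ∷ (rowC , + 0) ∷ []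
  rows 𝟐 = (rowB , + 0) ∷ (rowC , + 0) ∷ []

  rowC≤rowB : rowC ≤ rowB
  rowC≤rowB = m≤m+n r₄ _
  rowB≤rowA : rowB ≤ rowA
  rowB≤rowA = m≤m+n rowB r₃

  rows-decreasing : ∀ α → Linked (_≥_ on proj₁) (rows α)
  rows-decreasing 𝟏 = ≤-trans rowC≤rowB rowB≤rowA ∷ ≤-refl ∷ [-]
  rows-decreasing 𝟐 = rowC≤rowB ∷ [-]

  conf : Configuration
  conf α = rowPartition (rows α) (rows-decreasing α)

  -- The difference of the two sides is r₁ - r₃, so this is `r₃≤r₁` with a common summand added.
  x+2a+c≤3b : r₂ + (2 * rowA + rowC) ≤ 3 * rowB
  x+2a+c≤3b = subst₂ _≤_ (ring₁ r₁ r₂ r₃ r₄) (ring₂ r₁ r₂ r₃ r₄)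
    (+-monoˡ-≤ (3 * r₄ + 2 * r₁ + 3 * r₂ + 3 * r₃) r₃≤r₁)
    where
    ring₁ : ∀ r₁ r₂ r₃ r₄ → r₃ + (3 * r₄ + 2 * r₁ + 3 * r₂ + 3 * r₃)
      ≡ r₂ + (2 * (r₄ + (r₁ + r₂ + r₃) + r₃) + r₄)
    ring₁ = ℕ-ring
    ring₂ : ∀ r₁ r₂ r₃ r₄ → r₁ + (3 * r₄ + 2 * r₁ + 3 * r₂ + 3 * r₃)
      ≡ 3 * (r₄ + (r₁ + r₂ + r₃))
    ring₂ = ℕ-ring

  conf-shape : ShapeOf s rowA rowB rowC conf
  conf-shape = record
    { c≤b     = rowC≤rowB
    ; b≤a     = rowB≤rowA
    ; b≤s     = subst (_≤ s) (ring r₁ r₂ r₃ r₄) total≤s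
    ; 2a+c≤3b = ≤-trans (m≤n+m _ r₂) x+2a+c≤3b
    ; rows₁   = sym (filter-map (0 <?_) proj₁ (rows 𝟏))
    ; rows₂   = sym (filter-map (0 <?_) proj₁ (rows 𝟐))
    }
    where
    ring : ∀ r₁ r₂ r₃ r₄ → r₁ + r₂ + r₃ + r₄ ≡ r₄ + (r₁ + r₂ + r₃)
    ring = ℕ-ring

  row-bounds : ∀ α → All (λ p → (+ 0 ℤ.≤ proj₂ p) × (proj₂ p ℤ.≤ vacancy s conf α (proj₁ p)))
                         (rows α)
  row-bounds 𝟏 =
      (ℤ.+≤+ z≤n , subst (ℤ._≤_ _) (sym (vacancy₁-a {ν = conf} conf-shape)) (+≤- r₂ _ x+2a+c≤3b))
    ∷ bound-c ∷ bound-c ∷ []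
    where bound-c = ℤ.≤-refl , ℤ.≤-reflexive (sym (vacancy₁-c {ν = conf} conf-shape))
  row-bounds 𝟐 = bound rowC≤rowB ≤-refl ∷ bound ≤-refl rowC≤rowB ∷ []
    where
    bound : ∀ {i} → rowC ≤ i → i ≤ rowB → (+ 0 ℤ.≤ + 0) × (+ 0 ℤ.≤ vacancy s conf 𝟐 i)
    bound c≤i i≤b = ℤ.≤-refl , ℤ.≤-reflexive (sym (vacancy₂-zero {ν = conf} conf-shape c≤i i≤b))

  fromIndex : RCᴴᵂ s
  fromIndex = record
    { ν        = conf
    ; J        = λ α i → riggingsAt i (rows α)
    ; J-length = λ α i → length-riggingsAt i (rows α)
    ; J-bounds = λ α i → All-riggingsAt
        {P = λ k x → (+ 0 ℤ.≤ x) × (x ℤ.≤ vacancy s conf α k)} i (row-bounds α)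
    ; dominant = dominant-shape {ν = conf} conf-shape
    }

  -- An empty row is discarded along with its rigging. No information is lost, because `rowA` is at
  -- least `r₂`.
  a≡0⇒x≡0 : rowA ≡ 0 → r₂ ≡ 0
  a≡0⇒x≡0 a≡0 = m+n≡0⇒n≡0 r₁ (m+n≡0⇒m≡0 (r₁ + r₂) (m+n≡0⇒n≡0 r₄ (m+n≡0⇒m≡0 rowB a≡0)))

  totalRigging₁ : totalRigging fromIndex 𝟏 ≡ + r₂
  totalRigging₁ = trans
    (∑-riggingsAt (rows 𝟏) (rows-decreasing 𝟏)
      (cong +_ ∘ a≡0⇒x≡0 ∷ (λ _ → refl) ∷ (λ _ → refl) ∷ []))
    (ℤ.+-identityʳ _)

  totalRigging₂ : totalRigging fromIndex 𝟐 ≡ + 0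
  totalRigging₂ = ∑-riggingsAt (rows 𝟐) (rows-decreasing 𝟐) ((λ _ → refl) ∷ (λ _ → refl) ∷ [])

  longest-rigging : headOr0 (J fromIndex 𝟏 rowA) ≡ + r₂
  longest-rigging = go rowA (≤-trans rowC≤rowB rowB≤rowA) a≡0⇒x≡0
    where
    -- The sum `rowA` is generalised to a variable in order to match on it. For a positive length
    -- the row comes first in the list, so its rigging is the head even if `rowC` has the same
    -- length.
    go : ∀ a → rowC ≤ a → (a ≡ 0 → r₂ ≡ 0) →
         headOr0 (riggingsAt a ((a , + r₂) ∷ (rowC , + 0) ∷ (rowC , + 0) ∷ [])) ≡ + r₂
    go zero c≤0 h rewrite n≤0⇒n≡0 c≤0 = cong +_ (sym (h refl))
    go a@(suc _) _ _ = cong (headOr0 ∘ map proj₂)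
      (filter-accept (λ p → proj₁ p ≟ a) {x = a , + r₂}
        {xs = nonzeroRows ((rowC , + 0) ∷ (rowC , + 0) ∷ [])} refl)

  cc-fromIndex : cc fromIndex ≡ (+ gr r) /1
  cc-fromIndex = begin
    cc fromIndex
      ≡⟨ cc≡ccFormula fromIndex ⟩
    ccFormula q (totalRigging fromIndex 𝟏) (totalRigging fromIndex 𝟐)
      ≡⟨ cong₂ (ccFormula q) totalRigging₁ totalRigging₂ ⟩
    ccFormula q (+ r₂) (+ 0)
      ≡⟨ cong (λ z → ccFormula z (+ r₂) (+ 0)) (quadraticForm-shape {ν = conf} conf-shape) ⟩
    ℚ.½ ℚ.* ((+ 2 ℤ.* n) /1) ℚ.+ w /1
      ≡⟨ half-double+ n w ⟩
    (n ℤ.+ w) /1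
      ≡⟨ cong _/1 (trans (cong (ℤ._+_ n) (ring₁ (+ r₂))) (cong +_ (ring₂ r₁ r₂ r₃ r₄))) ⟩
    (+ gr r) /1 ∎
    where
    open ≡-Reasoning
    q n w : ℤ
    q = quadraticForm (parts (conf 𝟏)) (parts (conf 𝟐))
    n = + (rowA + (rowC + rowC))
    w = + 1 ℤ.* + r₂ ℤ.+ (+ 3 ℤ.* + 0 ℤ.+ + 0)
    ring₁ : ∀ x → + 1 ℤ.* x ℤ.+ (+ 3 ℤ.* + 0 ℤ.+ + 0) ≡ x
    ring₁ = ℤ-ring
    ring₂ : ∀ r₁ r₂ r₃ r₄ → r₄ + (r₁ + r₂ + r₃) + r₃ + (r₄ + r₄) + r₂
                          ≡ r₁ + 2 * r₂ + 2 * r₃ + 3 * r₄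
    ring₂ = ℕ-ring

  wt-fromIndex : wtRC fromIndex ≡ wt𝒜 r
  wt-fromIndex = trans (wt-shape {ν = conf} conf-shape) (cong₂ _,_
    (trans (cong₂ ℤ._-_ (ℤ.pos-* 3 (rowB + rowC)) (ℤ.pos-* 2 (rowA + (rowC + rowC))))
           (ring₁ (+ s) (+ r₁) (+ r₂) (+ r₃) (+ r₄)))
    (trans (cong (ℤ._-_ (+ (s + (rowA + (rowC + rowC))))) (ℤ.pos-* 2 (rowB + rowC)))
           (ring₂ (+ s) (+ r₁) (+ r₂) (+ r₃) (+ r₄))))
    where
    ring₁ : ∀ s r₁ r₂ r₃ r₄ →
      + 3 ⊠ (r₄ ⊞ (r₁ ⊞ r₂ ⊞ r₃) ⊞ r₄) ⊟ + 2 ⊠ (r₄ ⊞ (r₁ ⊞ r₂ ⊞ r₃) ⊞ r₃ ⊞ (r₄ ⊞ r₄))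
      ≡ (r₁ ⊞ r₂ ⊟ r₃) ⊠ + 1 ⊞ (s ⊟ r₁ ⊟ r₂ ⊟ r₄) ⊠ + 0
    ring₁ = ℤ-ring
    ring₂ : ∀ s r₁ r₂ r₃ r₄ →
      s ⊞ (r₄ ⊞ (r₁ ⊞ r₂ ⊞ r₃) ⊞ r₃ ⊞ (r₄ ⊞ r₄)) ⊟ + 2 ⊠ (r₄ ⊞ (r₁ ⊞ r₂ ⊞ r₃) ⊞ r₄)
      ≡ (r₁ ⊞ r₂ ⊟ r₃) ⊠ + 0 ⊞ (s ⊟ r₁ ⊟ r₂ ⊟ r₄) ⊠ + 1
    ring₂ = ℤ-ring

  ≈fromIndex : (R : RCᴴᵂ s) → ShapeOf s rowA rowB rowC (ν R) →
               headOr0 (J R 𝟏 rowA) ≡ + r₂ → R ≈ᴿᶜ fromIndex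
  ≈fromIndex R sh head = same-parts , λ α i →
    ↭-reflexive (riggings-unique R fromIndex sh conf-shape (trans head (sym longest-rigging)) α i)
    where
    same-parts : ∀ α → parts (ν R α) ≡ parts (conf α)
    same-parts 𝟏 = trans (Shape.rows₁ sh) (sym (Shape.rows₁ conf-shape))
    same-parts 𝟐 = trans (Shape.rows₂ sh) (sym (Shape.rows₂ conf-shape))

-- The index of a rigged configuration

slack : ∀ x c k l → x + (2 * (c + k + l) + c) ≤ 3 * (c + k) → 2 * l + x ≤ k
slack x c k l le = +-cancelʳ-≤ (3 * c + 2 * k) _ _ (subst₂ _≤_ (ring₁ x c k l) (ring₂ c k) le)
  where
  ring₁ : ∀ x c k l → x + (2 * (c + k + l) + c) ≡ 2 * l + x + (3 * c + 2 * k)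
  ring₁ = ℕ-ring
  ring₂ : ∀ c k → 3 * (c + k) ≡ k + (3 * c + 2 * k)
  ring₂ = ℕ-ring

-- Subtraction is avoided by naming differences: k = b - c, l = a - b and d = k - 2l - x = 3b - 2a -
-- c - x. Then 2b - a - c - x is l + d, and `r₃≤r₁` is immediate.
index : ∀ {s} x a b c → c ≤ b → b ≤ a → b ≤ s → x + (2 * a + c) ≤ 3 * b →
        Σ[ r ∈ 𝒜 s ] 𝒜.r₂ r ≡ x × rowA r ≡ a × rowB r ≡ b × rowC r ≡ c
index {s} x a b c c≤b b≤a b≤s le
  with k , refl ← m≤n⇒∃[o]m+o≡n c≤b
  with l , refl ← m≤n⇒∃[o]m+o≡n b≤a
  with d , refl ← m≤n⇒∃[o]m+o≡n (slack x c k l le) =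
  record { r₁ = l + d ; r₂ = x ; r₃ = l ; r₄ = c
         ; r₃≤r₁ = m≤m+n l d ; total≤s = subst (_≤ s) (ring₁ x c l d) b≤s }
  , refl , cong (_+ l) (ring₂ x c l d) , ring₂ x c l d , refl
  where
  ring₁ : ∀ x c l d → c + (2 * l + x + d) ≡ l + d + x + l + c
  ring₁ = ℕ-ring
  ring₂ : ∀ x c l d → c + (l + d + x + l) ≡ c + (2 * l + x + d)
  ring₂ = ℕ-ring

headOr0-All : ∀ {P : ℤ → Set} {xs} → P (+ 0) → All P xs → P (headOr0 xs)
headOr0-All p0 []      = p0
headOr0-All _  (p ∷ _) = p

toIndex : ∀ {s} (R : RCᴴᵂ s) → Σ[ r ∈ 𝒜 s ] R ≈ᴿᶜ fromIndex r
toIndex {s} R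
  with a , b , c , sh ← classify-shape _ _ (decreasing (ν R 𝟏)) (decreasing (ν R 𝟐)) (admissible R)
  -- The head is abstracted together with its bounds, which rule out a negative value. If the list
  -- is empty, the default 0 satisfies them because 2a + c ≤ 3b.
  with headOr0 (J R 𝟏 a) in head
     | headOr0-All {P = λ x → (+ 0 ℤ.≤ x) × (x ℤ.≤ + (3 * b) ℤ.- + (2 * a + c))}
         (ℤ.≤-refl , +≤- 0 _ (Shape.2a+c≤3b sh))
         (subst (λ p → All (λ x → (+ 0 ℤ.≤ x) × (x ℤ.≤ p)) (J R 𝟏 a))
                (vacancy₁-a {ν = ν R} sh) (J-bounds R 𝟏 a))
... | -[1+ _ ] | () , _
... | + x      | _  , x≤p
  with r , refl , refl , refl , refl ←
         index x a b c (Shape.c≤b sh) (Shape.b≤a sh) (Shape.b≤s sh) (+≤-⁻ x (2 * a + c) x≤p) =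
  r , ≈fromIndex r R sh head

𝒜-≡ : ∀ {s} {r r′ : 𝒜 s} → 𝒜.r₁ r ≡ 𝒜.r₁ r′ → 𝒜.r₂ r ≡ 𝒜.r₂ r′ →
      𝒜.r₃ r ≡ 𝒜.r₃ r′ → 𝒜.r₄ r ≡ 𝒜.r₄ r′ → r ≡ r′
𝒜-≡ {r = record { r₃≤r₁ = p ; total≤s = q }} {record { r₃≤r₁ = p′ ; total≤s = q′ }}
  refl refl refl refl
  rewrite ≤-irrelevant p p′ | ≤-irrelevant q q′ = refl

secondOr0 : List ℕ → ℕ
secondOr0 (_ ∷ x ∷ _) = x
secondOr0 _           = 0

second-row : ∀ {s a b c ν} → ShapeOf s a b c ν → secondOr0 (parts (ν 𝟐)) ≡ c
second-row {b = b} {c} sh = trans (cong secondOr0 (Shape.rows₂ sh)) (go b c (Shape.c≤b sh))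
  where
  go : ∀ b c → c ≤ b → secondOr0 (nonzero (b ∷ c ∷ [])) ≡ c
  go zero    zero    _ = refl
  go (suc _) zero    _ = refl
  go (suc _) (suc _) _ = refl

-- The index is recovered from invariants of the class: c from the second row of ν⁽²⁾, b and a from
-- the two sizes, and x from the total rigging of ν⁽¹⁾, which, unlike the head of a list, does not
-- depend on the order.
fromIndex-injective : ∀ {s} (r r′ : 𝒜 s) → fromIndex r ≈ᴿᶜ fromIndex r′ → r ≡ r′
fromIndex-injective r r′ eq@(same , _) = 𝒜-≡ r₁-eq r₂-eq r₃-eq c-eq
  where
  open 𝒜
  c-eq : r₄ r ≡ r₄ r′
  c-eq = trans (sym (second-row {ν = conf r} (conf-shape r)))
    (trans (cong secondOr0 (same 𝟐)) (second-row {ν = conf r′} (conf-shape r′)))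
  b-eq : rowB r ≡ rowB r′
  b-eq = +-cancelʳ-≡ (r₄ r) _ _ (trans (sym (size₂ {ν = conf r} (conf-shape r)))
    (trans (cong sumℕ (same 𝟐)) (trans (size₂ {ν = conf r′} (conf-shape r′))
      (cong (_+_ (rowB r′)) (sym c-eq)))))
  a-eq : rowA r ≡ rowA r′
  a-eq = +-cancelʳ-≡ (r₄ r + r₄ r) _ _ (trans (sym (size₁ {ν = conf r} (conf-shape r)))
    (trans (cong sumℕ (same 𝟏)) (trans (size₁ {ν = conf r′} (conf-shape r′))
      (cong (λ c → rowA r′ + (c + c)) (sym c-eq)))))
  r₂-eq : r₂ r ≡ r₂ r′
  r₂-eq = ℤ.+-injective (trans (sym (totalRigging₁ r))
    (trans (totalRigging-cong {R = fromIndex r} {fromIndex r′} eq 𝟏) (totalRigging₁ r′)))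
  r₃-eq : r₃ r ≡ r₃ r′
  r₃-eq = +-cancelˡ-≡ (rowB r) _ _ (trans a-eq (cong (_+ r₃ r′) (sym b-eq)))
  r₁-eq : r₁ r ≡ r₁ r′
  r₁-eq = +-cancelʳ-≡ (r₂ r) _ _ (trans (+-cancelʳ-≡ (r₃ r) _ _ (trans
    (+-cancelˡ-≡ (r₄ r) _ _ (trans b-eq (cong (_+ (r₁ r′ + r₂ r′ + r₃ r′)) (sym c-eq))))
    (cong (_+_ (r₁ r′ + r₂ r′)) (sym r₃-eq)))) (cong (_+_ (r₁ r′)) (sym r₂-eq)))

proposition4p9 : ∀ (s : ℕ) → s ≥ 1 →
    Σ[ Ψ ∈ Bijection (RCᴴᵂ-setoid s) (𝒜-setoid s) ]
    (∀ (R : RCᴴᵂ s) →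
    (cc R ≡ (+ gr (Bijection.to Ψ R)) /1)
    × (wtRC R ≡ wt𝒜 (Bijection.to Ψ R)))
proposition4p9 s _ = record
  { to        = to
  -- The choices made by `toIndex` depend on the representative, but `R` is equivalent to
  -- `fromIndex` of both indices, so they coincide.
  ; cong      = λ {R} {R′} R≈R′ → unique R (≈-to R)
                  (≈.trans {R} {R′} {fromIndex (to R′)} R≈R′ (≈-to R′))
  ; bijective = (λ {R} {R′} eq → ≈.trans {R} {fromIndex (to R)} {R′} (≈-to R)
                  (≈.sym {R′} {fromIndex (to R)}
                    (subst (λ r → R′ ≈ᴿᶜ fromIndex r) (sym eq) (≈-to R′))))
              , λ r → fromIndex r , λ {R} → unique R (≈-to R)
  }
  , λ R → trans (cc-cong {R = R} {fromIndex (to R)} (≈-to R)) (cc-fromIndex (to R))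
        , trans (wt-cong {R = R} {fromIndex (to R)} (≈-to R)) (wt-fromIndex (to R))
  where
  module ≈ = Setoid (RCᴴᵂ-setoid s)
  to : RCᴴᵂ s → 𝒜 s
  to R = proj₁ (toIndex R)
  ≈-to : ∀ R → R ≈ᴿᶜ fromIndex (to R)
  ≈-to R = proj₂ (toIndex R)
  unique : ∀ R {r r′} → R ≈ᴿᶜ fromIndex r → R ≈ᴿᶜ fromIndex r′ → r ≡ r′
  unique R {r} {r′} p q = fromIndex-injective r r′
    (≈.trans {fromIndex r} {R} {fromIndex r′} (≈.sym {R} {fromIndex r} p) q)
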